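{- Let $n\geq 2$ be an integer. (1) If $n\not\equiv 0\pmod 3$, then for every prime power $q\geq 2$ there exists a scattered $\mathbb{F}_q$-linear set of rank $3n$ in $PG(2,q^{2n})$. (2) If $n\equiv 0\pmod 3$, then for every prime power $q\equiv 1\pmod 3$ there exists a scattered $\mathbb{F}_q$-linear set of rank $3n$ in $PG(2,q^{2n})$.
   Context: For an $\mathbb{F}_q$-subspace $U$ of $\mathbb{F}_{q^{2n}}^3$ of $\mathbb{F}_q$-dimension $k$, $L_U=\{\langle u\rangle_{\mathbb{F}_{q^{2n}}}: u\in U\setminus\{0\}\}\subseteq PG(2,q^{2n})$ is an $\mathbb{F}_q$-linear set of rank $k$; it is scattered if every point $\langle v\rangle$ of $L_U$ satisfies $\dim_{\mathbb{F}_q}(U\cap\langle v\rangle_{\mathbb{F}_{q^{2n}}})=1$. -}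

module Defs where

open import Level using (Level; _⊔_)
open import Data.Nat as ℕ using (ℕ; zero; suc)
open import Data.Nat.Primality using (Prime)
open import Data.Fin using (Fin; zero; suc)
open import Data.Product using (Σ; ∃; _×_; _,_)
open import Relation.Nullary using (¬_)
open import Relation.Binary.PropositionalEquality using (_≡_)
open import Algebra.Bundles using (CommutativeRing)

IsPrimePower : ℕ → Set
IsPrimePower q = Σ ℕ λ p → Σ ℕ λ e → Prime p × 1 ℕ.≤ e × q ≡ p ℕ.^ e

module _ {c ℓ : Level} (K : CommutativeRing c ℓ) where
  open CommutativeRing K using (_≈_; _+_; _*_; 0#; 1#) renaming (Carrier to A)

  IsField : Set (c ⊔ ℓ)
  IsField = (¬ (1# ≈ 0#)) × (∀ x → ¬ (x ≈ 0#) → Σ A λ y → x * y ≈ 1#)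

  HasSize : ℕ → Set (c ⊔ ℓ)
  HasSize N = Σ (Fin N → A) λ f →
                (∀ y → Σ (Fin N) λ i → f i ≈ y) × (∀ i j → f i ≈ f j → i ≡ j)

  pow : A → ℕ → A
  pow x zero = 1#
  pow x (suc m) = x * pow x m

  -- the subfield F_q of K: elements fixed by x ↦ x^q
  -- (in a field of order q^(2n) this is exactly the subfield of order q)
  InFq : ℕ → A → Set ℓ
  InFq q x = pow x q ≈ x

  -- vectors of K^3 (coordinates of points of PG(2,K))
  V3 : Set c
  V3 = Fin 3 → A

  _≈v_ : V3 → V3 → Set ℓ
  u ≈v w = ∀ i → u i ≈ w i

  0v : V3
  0v _ = 0#

  _+v_ : V3 → V3 → V3
  (u +v w) i = u i + w i

  _·v_ : A → V3 → V3
  (a ·v u) i = a * u i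

  lincomb : (k : ℕ) → (Fin k → A) → (Fin k → V3) → V3
  lincomb zero cs bs = 0v
  lincomb (suc k) cs bs = (cs zero ·v bs zero) +v lincomb k (λ i → cs (suc i)) (λ i → bs (suc i))

  InSpan : ℕ → (k : ℕ) → (Fin k → V3) → V3 → Set (c ⊔ ℓ)
  InSpan q k bs w = Σ (Fin k → A) λ cs → (∀ i → InFq q (cs i)) × (w ≈v lincomb k cs bs)

  FqIndependent : ℕ → (k : ℕ) → (Fin k → V3) → Set (c ⊔ ℓ)
  FqIndependent q k bs = ∀ (cs : Fin k → A) → (∀ i → InFq q (cs i)) →
                         lincomb k cs bs ≈v 0v → ∀ i → cs i ≈ 0#

  HasFqDim : ℕ → (V3 → Set (c ⊔ ℓ)) → ℕ → Set (c ⊔ ℓ)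
  HasFqDim q W d = Σ (Fin d → V3) λ bs →
                     (∀ i → W (bs i)) × FqIndependent q d bs ×
                     (∀ w → W w → InSpan q d bs w)

  -- U = F_q-span of the basis bs (of rank k) defines a scattered linear set L_U:
  -- every point <v> of L_U (v ∈ U, v ≠ 0) satisfies dim_Fq (U ∩ <v>_K) = 1
  Scattered : ℕ → (k : ℕ) → (Fin k → V3) → Set (c ⊔ ℓ)
  Scattered q k bs = ∀ v → InSpan q k bs v → ¬ (v ≈v 0v) →
    HasFqDim q (λ w → InSpan q k bs w × Σ A λ λ₀ → w ≈v (λ₀ ·v v)) 1

  ExistsScatteredLinearSet : ℕ → ℕ → Set (c ⊔ ℓ)
  ExistsScatteredLinearSet q k =
    Σ (Fin k → V3) λ bs → FqIndependent q k bs × Scattered q k bs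

{-# OPTIONS --safe #-}
module Submission where

-- Write σ for x ↦ x^q, F for the subfield of order q^n of K, and ω for an element of K outside F.
-- On F_q the map r ↦ r³ - r is not injective, so it misses some γ and E = F_q[t]/(t³ - t - γ) is a
-- cubic field. Identify K³ with R = K[t]/(t³ - t - γ), let σ act on coefficients, and take
-- U = { ω x + a σ(x) : x ∈ F³ } with a = u + t, where u ∈ F is chosen so that the norm
-- N(a) = a σ(a) ⋯ σ^(n-1)(a) ∈ E does not lie in F_q. Such a u exists because the t-coordinate of
-- N(x + t) is a monic polynomial in x of degree q + ⋯ + q^(n-1) < q^n.
-- If (α + β ω)(ω x + a σ(x)) ∈ U with β ≠ 0, then w = (a σ(x) , x) satisfies M w = σ(β) a σ(w) for a
-- 2 × 2 matrix M over F. Iterating n times, w is an eigenvector of M' = σ^(n-1)(M) ⋯ σ(M) M with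
-- eigenvalue Y = N(σ(β)) N(a). As σ(M') is conjugate to M' by M, its characteristic polynomial is over
-- F_q, so Y is a root of a quadratic over F_q, which is absurd for an element of E outside F_q.
-- Hence β = 0, and comparing coordinates gives σ(α) = α.
-- A basis of U is found greedily: U has q^(3n) elements and k vectors span at most q^k.

-- R is a field exactly when 3 does not divide n; otherwise the cubic splits over K and R is a
-- product of three copies of K. Cancellation in R therefore has to be earned: whatever is cancelled
-- is first shown to be fixed by σ on coefficients, hence to lie in E, and a nonzero element of the
-- field E is a non-zero-divisor of R. This is why norms enter twice, once to cancel a, which
-- divides N(a), and once to bring the eigenvalue Y into E; and why the quadratic at Y keeps its
-- factor x until it is known to lie in E. The final contradiction is one of degrees: an element of
-- E outside F_q has degree 3 over F_q. The polynomial t³ - t - γ suits every characteristic, since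
-- 0 and 1 always collide under r ↦ r³ - r and a cubic without a root in F_q is irreducible there.
-- The t-coordinate of N(a) is singled out because the scalar N(σ(β)) only rescales it, so that Y
-- inherits a nonzero t-coordinate.

open import Defs
open import Level using (Level; _⊔_)
open import Data.Nat as ℕ using (ℕ; zero; suc; _!)
import Data.Nat.Properties as ℕₚ
open import Data.Nat.Combinatorics using (_C_; nCk≡n!/k![n-k]!; k![n∸k]!∣n!; nCn≡1)
open import Data.Nat.DivMod using (m/n*n≡m)
open import Data.Nat.Divisibility using (_∣_; divides; m∣m*n; >⇒∤)
open import Data.Nat.Primality using (Prime; euclidsLemma; prime⇒nonTrivial; prime⇒nonZero)
open import Data.Fin as Fin using (Fin; zero; suc; fromℕ; inject₁; punchIn; punchOut)
import Data.Fin.Properties as Finₚ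
open import Data.Fin.Patterns using (0F; 1F; 2F)
open import Data.Fin.Permutation using (Permutation′; permutation)
open import Data.Maybe.Base using (Maybe; just; nothing)
open import Data.Product using (Σ; ∃; _×_; _,_; proj₁; proj₂)
open import Data.Sum using (_⊎_; inj₁; inj₂)
open import Function using (_∘_)
open import Relation.Binary using (Decidable)
open import Relation.Nullary using (¬_; Dec; yes; no; contradiction)
open import Relation.Nullary.Decidable using (map′)
open import Relation.Binary.PropositionalEquality as ≡ using (_≡_; _≢_)
open import Algebra.Bundles using (CommutativeMonoid; CommutativeRing; RawRing)
open import Algebra.Morphism.Structures using (IsRingHomomorphism)
import Algebra.Morphism.Construct.Composition as Composition
import Algebra.Morphism.Construct.Identity as Identity
import Algebra.Properties.Ring
import Algebra.Solver.Ring
open import Algebra.Solver.Ring.AlmostCommutativeRing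
  using (fromCommutativeRing; _-Raw-AlmostCommutative⟶_)

-- A ring solver with integer coefficients.

-- The coefficient (m , n) stands for the integer m - n.
module IntegerSolver {c ℓ} (S : CommutativeRing c ℓ) where
  open CommutativeRing S hiding (zero)
  open import Algebra.Properties.Ring ring using (-‿distribˡ-*; -‿distribʳ-*; -‿involutive; -‿+-comm; -0#≈0#)
  open import Algebra.Properties.CommutativeSemigroup +-commutativeSemigroup using (interchange)
  open import Algebra.Properties.Semiring.Mult semiring
    using (×-homo-+; ×1-homo-*) renaming (_×_ to _×ᵤ_)
  open import Algebra.Properties.Semiring.Mult.TCOptimised semiring using (×ᵤ≈×) renaming (_×_ to _×ₒ_)
  open import Relation.Binary.Reasoning.Setoid setoid

  differences : RawRing _ _
  differences = record
    { Carrier = ℕ × ℕ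
    ; _≈_     = _≡_
    ; _+_     = λ { (a , b) (a' , b') → a ℕ.+ a' , b ℕ.+ b' }
    ; _*_     = λ { (a , b) (a' , b') → a ℕ.* a' ℕ.+ b ℕ.* b' , a ℕ.* b' ℕ.+ b ℕ.* a' }
    ; -_      = λ { (a , b) → b , a }
    ; 0#      = 0 , 0
    ; 1#      = 1 , 0
    }

  diff : ℕ → ℕ → Carrier
  diff a b = a ×ᵤ 1# - b ×ᵤ 1#

  +-cancel-sub : ∀ {x y z w} → x + w ≈ z + y → x - y ≈ z - w
  +-cancel-sub {x} {y} {z} {w} h = begin
    x - y              ≈⟨ +-congʳ (+-identityʳ x) ⟨
    x + 0# - y         ≈⟨ +-congʳ (+-congˡ (-‿inverseʳ w)) ⟨
    x + (w - w) - y    ≈⟨ +-congʳ (+-assoc x w (- w)) ⟨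
    (x + w - w) - y    ≈⟨ +-congʳ (+-congʳ h) ⟩
    (z + y - w) - y    ≈⟨ +-assoc _ _ _ ⟩
    z + y + (- w - y)  ≈⟨ +-congˡ (+-comm _ _) ⟩
    z + y + (- y - w)  ≈⟨ +-assoc _ _ _ ⟩
    z + (y + (- y - w)) ≈⟨ +-congˡ (+-assoc _ _ _) ⟨
    z + (y - y - w)    ≈⟨ +-congˡ (+-congʳ (-‿inverseʳ y)) ⟩
    z + (0# - w)       ≈⟨ +-congˡ (+-identityˡ _) ⟩
    z - w              ∎

  -- Cancelling makes equal integers denote the same element on the nose, as the solver requires.
  ⟦_⟧ : ℕ × ℕ → Carrier
  ⟦ a     , zero ⟧  = a ×ₒ 1#
  ⟦ zero  , suc b ⟧ = - (suc b ×ₒ 1#)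
  ⟦ suc a , suc b ⟧ = ⟦ a , b ⟧

  ⟦⟧≈diff : ∀ a b → ⟦ a , b ⟧ ≈ diff a b
  ⟦⟧≈diff a zero = begin
    a ×ₒ 1#            ≈⟨ ×ᵤ≈× a 1# ⟨
    a ×ᵤ 1#            ≈⟨ +-identityʳ _ ⟨
    a ×ᵤ 1# + 0#       ≈⟨ +-congˡ -0#≈0# ⟨
    diff a zero        ∎
  ⟦⟧≈diff zero (suc b) = trans (-‿cong (sym (×ᵤ≈× (suc b) 1#))) (sym (+-identityˡ _))
  ⟦⟧≈diff (suc a) (suc b) = trans (⟦⟧≈diff a b) (+-cancel-sub (begin
    a ×ᵤ 1# + (1# + b ×ᵤ 1#)  ≈⟨ +-assoc _ _ _ ⟨
    a ×ᵤ 1# + 1# + b ×ᵤ 1#    ≈⟨ +-congʳ (+-comm _ _) ⟩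
    1# + a ×ᵤ 1# + b ×ᵤ 1#    ∎))

  homomorphism : differences -Raw-AlmostCommutative⟶ fromCommutativeRing S
  homomorphism = record
    { ⟦_⟧    = ⟦_⟧
    ; +-homo = λ { (a , b) (a' , b') → trans (⟦⟧≈diff _ (b ℕ.+ b'))
        (trans (+-homo a b a' b') (sym (+-cong (⟦⟧≈diff a b) (⟦⟧≈diff a' b')))) }
    ; *-homo = λ { (a , b) (a' , b') → trans (⟦⟧≈diff _ (a ℕ.* b' ℕ.+ b ℕ.* a'))
        (trans (*-homo a b a' b') (sym (*-cong (⟦⟧≈diff a b) (⟦⟧≈diff a' b')))) }
    ; -‿homo = λ { (a , b) → trans (⟦⟧≈diff b a)
        (trans (-‿homo (a ×ᵤ 1#) (b ×ᵤ 1#)) (-‿cong (sym (⟦⟧≈diff a b)))) }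
    ; 0-homo = refl
    ; 1-homo = refl
    }
    where
    +-homo : ∀ a b a' b' → diff (a ℕ.+ a') (b ℕ.+ b') ≈ diff a b + diff a' b'
    +-homo a b a' b' = begin
      diff (a ℕ.+ a') (b ℕ.+ b')
        ≈⟨ +-cong (×-homo-+ 1# a a') (-‿cong (×-homo-+ 1# b b')) ⟩
      (a ×ᵤ 1# + a' ×ᵤ 1#) - (b ×ᵤ 1# + b' ×ᵤ 1#)
        ≈⟨ +-congˡ (-‿+-comm _ _) ⟨
      (a ×ᵤ 1# + a' ×ᵤ 1#) + (- (b ×ᵤ 1#) - b' ×ᵤ 1#)
        ≈⟨ interchange _ _ _ _ ⟩
      diff a b + diff a' b' ∎

    -‿homo : ∀ x y → y - x ≈ - (x - y)
    -‿homo x y = begin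
      y - x         ≈⟨ +-comm _ _ ⟩
      - x + y       ≈⟨ +-congˡ (-‿involutive y) ⟨
      - x - (- y)   ≈⟨ -‿+-comm _ _ ⟩
      - (x - y)     ∎

    expand : ∀ x y z w → (x * z + y * w) - (x * w + y * z) ≈ (x - y) * (z - w)
    expand x y z w = sym (begin
      (x - y) * (z - w)
        ≈⟨ distribʳ _ _ _ ⟩
      x * (z - w) + - y * (z - w)
        ≈⟨ +-cong (distribˡ _ _ _) (trans (distribˡ _ _ _) (+-comm _ _)) ⟩
      (x * z + x * - w) + (- y * - w + - y * z)
        ≈⟨ interchange _ _ _ _ ⟩
      (x * z + - y * - w) + (x * - w + - y * z)
        ≈⟨ +-cong (+-congˡ -y*-w) (+-cong (sym (-‿distribʳ-* _ _)) (sym (-‿distribˡ-* _ _))) ⟩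
      (x * z + y * w) + (- (x * w) - (y * z))
        ≈⟨ +-congˡ (-‿+-comm _ _) ⟩
      (x * z + y * w) - (x * w + y * z) ∎)
      where
      -y*-w : - y * - w ≈ y * w
      -y*-w = begin
        - y * - w       ≈⟨ -‿distribˡ-* _ _ ⟨
        - (y * - w)     ≈⟨ -‿cong (-‿distribʳ-* _ _) ⟨
        - - (y * w)     ≈⟨ -‿involutive _ ⟩
        y * w           ∎

    *-homo : ∀ a b a' b' →
      diff (a ℕ.* a' ℕ.+ b ℕ.* b') (a ℕ.* b' ℕ.+ b ℕ.* a') ≈ diff a b * diff a' b'
    *-homo a b a' b' = trans
      (+-cong (homo a a' b b') (-‿cong (homo a b' b a')))
      (expand _ _ _ _)
      where
      homo : ∀ m n m' n' → (m ℕ.* n ℕ.+ m' ℕ.* n') ×ᵤ 1#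
                         ≈ (m ×ᵤ 1#) * (n ×ᵤ 1#) + (m' ×ᵤ 1#) * (n' ×ᵤ 1#)
      homo m n m' n' = trans (×-homo-+ 1# (m ℕ.* n) (m' ℕ.* n'))
                             (+-cong (×1-homo-* m n) (×1-homo-* m' n'))

  _coeff≟_ : ∀ x y → Maybe (⟦ x ⟧ ≈ ⟦ y ⟧)
  (a , b) coeff≟ (a' , b') with a ℕ.+ b' ℕ.≟ a' ℕ.+ b
  ... | no _  = nothing
  ... | yes e = just (trans (⟦⟧≈diff a b) (trans (+-cancel-sub (begin
    a ×ᵤ 1# + b' ×ᵤ 1#   ≈⟨ ×-homo-+ 1# a b' ⟨
    (a ℕ.+ b') ×ᵤ 1#     ≡⟨ ≡.cong (_×ᵤ 1#) e ⟩
    (a' ℕ.+ b) ×ᵤ 1#     ≈⟨ ×-homo-+ 1# a' b ⟩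
    a' ×ᵤ 1# + b ×ᵤ 1#   ∎)) (sym (⟦⟧≈diff a' b'))))

  open Algebra.Solver.Ring differences (fromCommutativeRing S) homomorphism _coeff≟_ public
    using (solve; _:=_; _:+_; _:*_; _:-_; :-_; con; Polynomial)

  nil one : ∀ {n} → Polynomial n
  nil = con (0 , 0)
  one = con (1 , 0)

-- The algebra R = K[t]/(t³ - t - γ).

module CubicExtension {c ℓ} (K : CommutativeRing c ℓ) (γ : CommutativeRing.Carrier K) where
  private module K = CommutativeRing K
  open K using (_+_; _*_; -_; _-_; 0#; 1#) renaming (Carrier to A; _≈_ to _≈_)
  open IntegerSolver K

  -- [ x₀ , x₁ , x₂ ] is the class of x₀ + x₁t + x₂t² in K[t]/(t³ - t - γ).
  record Cubic : Set c where
    constructor [_,_,_]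
    field
      c₀ c₁ c₂ : A
  open Cubic public

  record _≋_ (x y : Cubic) : Set ℓ where
    constructor ≋[_,_,_]
    field
      ≋₀ : c₀ x ≈ c₀ y
      ≋₁ : c₁ x ≈ c₁ y
      ≋₂ : c₂ x ≈ c₂ y
  open _≋_ public

  infixl 6 _⊕_
  infixl 7 _⊛_
  infix 4 _≋_

  -- Products are reduced by t³ = t + γ and t⁴ = t² + γ t: the t³-coefficient x₁y₂ + x₂y₁ enters
  -- coordinates 1 and 0, the t⁴-coefficient x₂y₂ enters coordinates 2 and 1.
  _⊕_ _⊛_ : Cubic → Cubic → Cubic
  [ x₀ , x₁ , x₂ ] ⊕ [ y₀ , y₁ , y₂ ] = [ x₀ + y₀ , x₁ + y₁ , x₂ + y₂ ]
  [ x₀ , x₁ , x₂ ] ⊛ [ y₀ , y₁ , y₂ ] =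
    [ x₀ * y₀ + γ * (x₁ * y₂ + x₂ * y₁)
    , x₀ * y₁ + x₁ * y₀ + (x₁ * y₂ + x₂ * y₁) + γ * (x₂ * y₂)
    , x₀ * y₂ + x₁ * y₁ + x₂ * y₀ + x₂ * y₂ ]

  ⊖_ : Cubic → Cubic
  ⊖ [ x₀ , x₁ , x₂ ] = [ - x₀ , - x₁ , - x₂ ]

  ι : A → Cubic
  ι x = [ x , 0# , 0# ]

  private
    ⊛-cong : ∀ {x y u v} → x ≋ y → u ≋ v → x ⊛ u ≋ y ⊛ v
    ⊛-cong ≋[ p₀ , p₁ , p₂ ] ≋[ q₀ , q₁ , q₂ ] =
      ≋[ K.+-cong (K.*-cong p₀ q₀) (K.*-congˡ p₁q₂)
       , K.+-cong (K.+-cong (K.+-cong (K.*-cong p₀ q₁) (K.*-cong p₁ q₀)) p₁q₂) (K.*-congˡ (K.*-cong p₂ q₂))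
       , K.+-cong (K.+-cong (K.+-cong (K.*-cong p₀ q₂) (K.*-cong p₁ q₁)) (K.*-cong p₂ q₀)) (K.*-cong p₂ q₂) ]
      where p₁q₂ = K.+-cong (K.*-cong p₁ q₂) (K.*-cong p₂ q₁)

    ⊛-comm : ∀ x y → x ⊛ y ≋ y ⊛ x
    ⊛-comm [ x₀ , x₁ , x₂ ] [ y₀ , y₁ , y₂ ] =
      ≋[ solve 7 (λ g a b c d e f → a :* d :+ g :* (b :* f :+ c :* e) :=
                                    d :* a :+ g :* (e :* c :+ f :* b)) K.refl γ x₀ x₁ x₂ y₀ y₁ y₂
       , solve 7 (λ g a b c d e f → a :* e :+ b :* d :+ (b :* f :+ c :* e) :+ g :* (c :* f) :=
                                    d :* b :+ e :* a :+ (e :* c :+ f :* b) :+ g :*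
                                        (f :* c)) K.refl γ x₀ x₁ x₂ y₀ y₁ y₂
       , solve 6 (λ a b c d e f → a :* f :+ b :* e :+ c :* d :+ c :* f :=
                                  d :* c :+ e :* b :+ f :* a :+ f :* c) K.refl x₀ x₁ x₂ y₀ y₁ y₂ ]

    ⊛-distribˡ : ∀ x y z → x ⊛ (y ⊕ z) ≋ x ⊛ y ⊕ x ⊛ z
    ⊛-distribˡ [ x₀ , x₁ , x₂ ] [ y₀ , y₁ , y₂ ] [ z₀ , z₁ , z₂ ] =
      ≋[ solve 10 (λ g a b c d e f h i j →
           a :* (d :+ h) :+ g :* (b :* (f :+ j) :+ c :* (e :+ i)) :=
           (a :* d :+ g :* (b :* f :+ c :* e)) :+ (a :* h :+ g :* (b :* j :+ c :* i)))
           K.refl γ x₀ x₁ x₂ y₀ y₁ y₂ z₀ z₁ z₂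
       , solve 10 (λ g a b c d e f h i j →
           a :* (e :+ i) :+ b :* (d :+ h) :+ (b :* (f :+ j) :+ c :* (e :+ i)) :+ g :* (c :* (f :+ j)) :=
           (a :* e :+ b :* d :+ (b :* f :+ c :* e) :+ g :* (c :* f)) :+
           (a :* i :+ b :* h :+ (b :* j :+ c :* i) :+ g :* (c :* j)))
           K.refl γ x₀ x₁ x₂ y₀ y₁ y₂ z₀ z₁ z₂
       , solve 9 (λ a b c d e f h i j →
           a :* (f :+ j) :+ b :* (e :+ i) :+ c :* (d :+ h) :+ c :* (f :+ j) :=
           (a :* f :+ b :* e :+ c :* d :+ c :* f) :+ (a :* j :+ b :* i :+ c :* h :+ c :* j))
           K.refl x₀ x₁ x₂ y₀ y₁ y₂ z₀ z₁ z₂ ]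

    ⊛-identityˡ : ∀ x → ι 1# ⊛ x ≋ x
    ⊛-identityˡ [ x₀ , x₁ , x₂ ] =
      ≋[ solve 4 (λ g a b c → one :* a :+ g :* (nil :* c :+ nil :* b) := a) K.refl γ x₀ x₁ x₂
       , solve 4 (λ g a b c → one :* b :+ nil :* a :+ (nil :* c :+ nil :* b) :+ g :* (nil :* c)
           := b) K.refl γ x₀ x₁ x₂
       , solve 3 (λ a b c → one :* c :+ nil :* b :+ nil :* a :+ nil :* c := c) K.refl x₀ x₁ x₂ ]

    -- Solver-level copies of the coordinates of `_⊛_`, so that a nested product can be written as
    -- one polynomial.
    mul₀ mul₁ mul₂ : ∀ {n} (g x₀ x₁ x₂ y₀ y₁ y₂ : Polynomial n) → Polynomial n
    mul₀ g x₀ x₁ x₂ y₀ y₁ y₂ = x₀ :* y₀ :+ g :* (x₁ :* y₂ :+ x₂ :* y₁)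
    mul₁ g x₀ x₁ x₂ y₀ y₁ y₂ = x₀ :* y₁ :+ x₁ :* y₀ :+ (x₁ :* y₂ :+ x₂ :* y₁) :+ g :* (x₂ :* y₂)
    mul₂ g x₀ x₁ x₂ y₀ y₁ y₂ = x₀ :* y₂ :+ x₁ :* y₁ :+ x₂ :* y₀ :+ x₂ :* y₂

    ⊛-assoc : ∀ x y z → (x ⊛ y) ⊛ z ≋ x ⊛ (y ⊛ z)
    ⊛-assoc [ x₀ , x₁ , x₂ ] [ y₀ , y₁ , y₂ ] [ z₀ , z₁ , z₂ ] =
      ≋[ solve 10 (λ g x₀ x₁ x₂ y₀ y₁ y₂ z₀ z₁ z₂ →
           mul₀ g (mul₀ g x₀ x₁ x₂ y₀ y₁ y₂) (mul₁ g x₀ x₁ x₂ y₀ y₁ y₂) (mul₂ g x₀ x₁ x₂ y₀ y₁ y₂) z₀ z₁ z₂ :=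
           mul₀ g x₀ x₁ x₂ (mul₀ g y₀ y₁ y₂ z₀ z₁ z₂) (mul₁ g y₀ y₁ y₂ z₀ z₁ z₂) (mul₂ g y₀ y₁ y₂ z₀ z₁ z₂))
           K.refl γ x₀ x₁ x₂ y₀ y₁ y₂ z₀ z₁ z₂
       , solve 10 (λ g x₀ x₁ x₂ y₀ y₁ y₂ z₀ z₁ z₂ →
           mul₁ g (mul₀ g x₀ x₁ x₂ y₀ y₁ y₂) (mul₁ g x₀ x₁ x₂ y₀ y₁ y₂) (mul₂ g x₀ x₁ x₂ y₀ y₁ y₂) z₀ z₁ z₂ :=
           mul₁ g x₀ x₁ x₂ (mul₀ g y₀ y₁ y₂ z₀ z₁ z₂) (mul₁ g y₀ y₁ y₂ z₀ z₁ z₂) (mul₂ g y₀ y₁ y₂ z₀ z₁ z₂))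
           K.refl γ x₀ x₁ x₂ y₀ y₁ y₂ z₀ z₁ z₂
       , solve 10 (λ g x₀ x₁ x₂ y₀ y₁ y₂ z₀ z₁ z₂ →
           mul₂ g (mul₀ g x₀ x₁ x₂ y₀ y₁ y₂) (mul₁ g x₀ x₁ x₂ y₀ y₁ y₂) (mul₂ g x₀ x₁ x₂ y₀ y₁ y₂) z₀ z₁ z₂ :=
           mul₂ g x₀ x₁ x₂ (mul₀ g y₀ y₁ y₂ z₀ z₁ z₂) (mul₁ g y₀ y₁ y₂ z₀ z₁ z₂) (mul₂ g y₀ y₁ y₂ z₀ z₁ z₂))
           K.refl γ x₀ x₁ x₂ y₀ y₁ y₂ z₀ z₁ z₂ ]

    ≋-trans : ∀ {x y z} → x ≋ y → y ≋ z → x ≋ z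
    ≋-trans ≋[ p₀ , p₁ , p₂ ] ≋[ q₀ , q₁ , q₂ ] = ≋[ K.trans p₀ q₀ , K.trans p₁ q₁ , K.trans p₂ q₂ ]

    ⊕-cong : ∀ {x y u v} → x ≋ y → u ≋ v → x ⊕ u ≋ y ⊕ v
    ⊕-cong ≋[ p₀ , p₁ , p₂ ] ≋[ q₀ , q₁ , q₂ ] = ≋[ K.+-cong p₀ q₀ , K.+-cong p₁ q₁ , K.+-cong p₂ q₂ ]

    ⊕-comm : ∀ x y → x ⊕ y ≋ y ⊕ x
    ⊕-comm _ _ = ≋[ K.+-comm _ _ , K.+-comm _ _ , K.+-comm _ _ ]

  cubicRing : CommutativeRing c ℓ
  cubicRing = record
    { Carrier = Cubic ; _≈_ = _≋_ ; _+_ = _⊕_ ; _*_ = _⊛_ ; -_ = ⊖_ ; 0# = ι 0# ; 1# = ι 1#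
    ; isCommutativeRing = record
      { isRing = record
        { +-isAbelianGroup = record
          { isGroup = record
            { isMonoid = record
              { isSemigroup = record
                { isMagma = record
                  { isEquivalence = record
                    { refl = ≋[ K.refl , K.refl , K.refl ]
                    ; sym = λ p → ≋[ K.sym (≋₀ p) , K.sym (≋₁ p) , K.sym (≋₂ p) ]
                    ; trans = ≋-trans }
                  ; ∙-cong = ⊕-cong }
                ; assoc = λ _ _ _ → ≋[ K.+-assoc _ _ _ , K.+-assoc _ _ _ , K.+-assoc _ _ _ ] }
              ; identity = (λ _ → ≋[ K.+-identityˡ _ , K.+-identityˡ _ , K.+-identityˡ _ ])
                         , (λ _ → ≋[ K.+-identityʳ _ , K.+-identityʳ _ , K.+-identityʳ _ ]) }
            ; inverse = (λ _ → ≋[ K.-‿inverseˡ _ , K.-‿inverseˡ _ , K.-‿inverseˡ _ ])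
                      , (λ _ → ≋[ K.-‿inverseʳ _ , K.-‿inverseʳ _ , K.-‿inverseʳ _ ])
            ; ⁻¹-cong = λ p → ≋[ K.-‿cong (≋₀ p) , K.-‿cong (≋₁ p) , K.-‿cong (≋₂ p) ] }
          ; comm = ⊕-comm }
        ; *-cong = ⊛-cong
        ; *-assoc = ⊛-assoc
        ; *-identity = ⊛-identityˡ , λ x → ≋-trans (⊛-comm x _) (⊛-identityˡ x)
        ; distrib = ⊛-distribˡ , λ x y z → ≋-trans (⊛-comm (y ⊕ z) x) (≋-trans (⊛-distribˡ x y z)
            (⊕-cong (⊛-comm x y) (⊛-comm x z))) }
      ; *-comm = ⊛-comm } }
  module _ {σ : A → A} (hom : IsRingHomomorphism K.rawRing K.rawRing σ) (σγ≈γ : σ γ ≈ γ) where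
    private
      module σ = IsRingHomomorphism hom
      σ-*+* : ∀ x y z w → σ (x * y + z * w) ≈ σ x * σ y + σ z * σ w
      σ-*+* x y z w = K.trans (σ.+-homo _ _) (K.+-cong (σ.*-homo _ _) (σ.*-homo _ _))
      σ-γ* : ∀ {x y} → σ x ≈ y → σ (γ * x) ≈ γ * y
      σ-γ* e = K.trans (σ.*-homo _ _) (K.*-cong σγ≈γ e)

    mapC : Cubic → Cubic
    mapC [ x₀ , x₁ , x₂ ] = [ σ x₀ , σ x₁ , σ x₂ ]

    -- Because σ fixes γ, applying it to coefficients commutes with the reduction t³ = t + γ.
    mapC-isRingHomomorphism : IsRingHomomorphism (CommutativeRing.rawRing cubicRing)
        (CommutativeRing.rawRing cubicRing) mapC
    mapC-isRingHomomorphism = record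
      { isSemiringHomomorphism = record
        { isNearSemiringHomomorphism = record
          { +-isMonoidHomomorphism = record
            { isMagmaHomomorphism = record
              { isRelHomomorphism = record
                { cong = λ p → ≋[ σ.⟦⟧-cong (≋₀ p) , σ.⟦⟧-cong (≋₁ p) , σ.⟦⟧-cong (≋₂ p) ] }
              ; homo = λ _ _ → ≋[ σ.+-homo _ _ , σ.+-homo _ _ , σ.+-homo _ _ ] }
            ; ε-homo = ≋[ σ.0#-homo , σ.0#-homo , σ.0#-homo ] }
          ; *-homo = λ _ _ →
              ≋[ K.trans (σ.+-homo _ _) (K.+-cong (σ.*-homo _ _) (σ-γ* (σ-*+* _ _ _ _)))
               , K.trans (σ.+-homo _ _) (K.+-cong (K.trans (σ.+-homo _ _) (K.+-cong (σ-*+* _ _ _ _)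
                   (σ-*+* _ _ _ _)))
                                                  (σ-γ* (σ.*-homo _ _)))
               , K.trans (σ.+-homo _ _) (K.+-cong (K.trans (σ.+-homo _ _) (K.+-cong (σ-*+* _ _ _ _)
                   (σ.*-homo _ _)))
                                                  (σ.*-homo _ _)) ] }
        ; 1#-homo = ≋[ σ.1#-homo , σ.0#-homo , σ.0#-homo ] }
      ; -‿homo = λ _ → ≋[ σ.-‿homo _ , σ.-‿homo _ , σ.-‿homo _ ] }

  ι* : ∀ k x → ι k ⊛ x ≋ [ k * c₀ x , k * c₁ x , k * c₂ x ]
  ι* k [ x₀ , x₁ , x₂ ] =
    ≋[ solve 5 (λ g k a b c → k :* a :+ g :* (nil :* c :+ nil :* b) := k :* a) K.refl γ k x₀ x₁ x₂
     , solve 5 (λ g k a b c → k :* b :+ nil :* a :+ (nil :* c :+ nil :* b) :+ g :* (nil :* c)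
         := k :* b) K.refl γ k x₀ x₁ x₂
     , solve 4 (λ k a b c → k :* c :+ nil :* b :+ nil :* a :+ nil :* c := k :* c) K.refl k x₀ x₁ x₂ ]

  ι-isRingHomomorphism : IsRingHomomorphism K.rawRing (CommutativeRing.rawRing cubicRing) ι
  ι-isRingHomomorphism = record
    { isSemiringHomomorphism = record
      { isNearSemiringHomomorphism = record
        { +-isMonoidHomomorphism = record
          { isMagmaHomomorphism = record
            { isRelHomomorphism = record { cong = λ p → ≋[ p , K.refl , K.refl ] }
            ; homo = λ _ _ → ≋[ K.refl , K.sym (K.+-identityˡ 0#) , K.sym (K.+-identityˡ 0#) ] }
          ; ε-homo = ≋[ K.refl , K.refl , K.refl ] }
        ; *-homo = λ k l → ≋-trans ≋[ K.refl , K.sym (K.zeroʳ k) , K.sym (K.zeroʳ k) ]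
                                   (CommutativeRing.sym cubicRing (ι* k (ι l))) }
      ; 1#-homo = ≋[ K.refl , K.refl , K.refl ] }
    ; -‿homo = λ _ → ≋[ K.refl , K.sym -0#≈0# , K.sym -0#≈0# ] }
    where open import Algebra.Properties.Ring K.ring using (-0#≈0#)

-- Iterated endomorphisms and norms.

iter : ∀ {a} {A : Set a} → (A → A) → ℕ → A → A
iter f zero    x = x
iter f (suc k) x = f (iter f k x)

iter-suc : ∀ {a} {A : Set a} (f : A → A) k x → iter f k (f x) ≡ f (iter f k x)
iter-suc f zero    x = ≡.refl
iter-suc f (suc k) x = ≡.cong f (iter-suc f k x)

iter-+ : ∀ {a} {A : Set a} (f : A → A) j k x → iter f (j ℕ.+ k) x ≡ iter f j (iter f k x)
iter-+ f zero    k x = ≡.refl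
iter-+ f (suc j) k x = ≡.cong f (iter-+ f j k x)

iter-isRingHomomorphism : ∀ {c ℓ} (S : CommutativeRing c ℓ) {f} →
  IsRingHomomorphism (CommutativeRing.rawRing S) (CommutativeRing.rawRing S) f → ∀ k →
  IsRingHomomorphism (CommutativeRing.rawRing S) (CommutativeRing.rawRing S) (iter f k)
iter-isRingHomomorphism S hom zero    = Identity.isRingHomomorphism (CommutativeRing.rawRing S)
    (CommutativeRing.refl S)
iter-isRingHomomorphism S hom (suc k) =
  Composition.isRingHomomorphism (CommutativeRing.trans S) (iter-isRingHomomorphism S hom k) hom

module Norm {c ℓ} (S : CommutativeRing c ℓ) {σ : CommutativeRing.Carrier S → CommutativeRing.Carrier S}
            (hom : IsRingHomomorphism (CommutativeRing.rawRing S) (CommutativeRing.rawRing S) σ) where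
  open CommutativeRing S hiding (zero)
  open import Relation.Binary.Reasoning.Setoid setoid
  open import Algebra.Properties.CommutativeSemigroup *-commutativeSemigroup using (interchange)
  private module σ = IsRingHomomorphism hom

  norm : ℕ → Carrier → Carrier
  norm zero    b = 1#
  norm (suc k) b = b * σ (norm k b)

  -- The definition splits off the first factor b, this splits off the last factor σ^k(b). Playing
  -- the two ends against each other gives invariance of the norm, and the right-hand form drives
  -- the degree induction for N(x + t).
  norm-sucʳ : ∀ k b → norm (suc k) b ≈ norm k b * iter σ k b
  norm-sucʳ zero b = trans (*-congˡ σ.1#-homo) (*-comm b 1#)
  norm-sucʳ (suc k) b = begin
    b * σ (norm (suc k) b)              ≈⟨ *-congˡ (σ.⟦⟧-cong (norm-sucʳ k b)) ⟩
    b * σ (norm k b * iter σ k b)       ≈⟨ *-congˡ (σ.*-homo _ _) ⟩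
    b * (σ (norm k b) * σ (iter σ k b)) ≈⟨ *-assoc _ _ _ ⟨
    norm (suc k) b * iter σ (suc k) b   ∎

  -- Applying σ shifts every factor by one place; the last becomes σⁿ(b) = b and returns to the
  -- front.
  norm-fixed : ∀ n {b} → iter σ n b ≈ b → σ (norm n b) ≈ norm n b
  norm-fixed zero    _ = σ.1#-homo
  norm-fixed (suc k) {b} fix = begin
    σ (norm (suc k) b)                  ≈⟨ σ.⟦⟧-cong (norm-sucʳ k b) ⟩
    σ (norm k b * iter σ k b)           ≈⟨ σ.*-homo _ _ ⟩
    σ (norm k b) * iter σ (suc k) b     ≈⟨ *-congˡ fix ⟩
    σ (norm k b) * b                    ≈⟨ *-comm _ _ ⟩
    norm (suc k) b                      ∎

  norm-* : ∀ k a b → norm k (a * b) ≈ norm k a * norm k b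
  norm-* zero    a b = sym (*-identityˡ 1#)
  norm-* (suc k) a b = begin
    a * b * σ (norm k (a * b))               ≈⟨ *-congˡ (σ.⟦⟧-cong (norm-* k a b)) ⟩
    a * b * σ (norm k a * norm k b)          ≈⟨ *-congˡ (σ.*-homo _ _) ⟩
    a * b * (σ (norm k a) * σ (norm k b))    ≈⟨ interchange _ _ _ _ ⟩
    norm (suc k) a * norm (suc k) b          ∎

-- Two-by-two matrices, twisted powers and semilinear eigenvectors.

module Matrices {c ℓ} (K : CommutativeRing c ℓ) {σ : CommutativeRing.Carrier K → CommutativeRing.Carrier K}
                (hom : IsRingHomomorphism (CommutativeRing.rawRing K) (CommutativeRing.rawRing K) σ) where
  open CommutativeRing K hiding (zero)
  open IntegerSolver K
  open import Relation.Binary.Reasoning.Setoid setoid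
  private module σ = IsRingHomomorphism hom

  record Mat : Set c where
    constructor mat
    field
      m₁₁ m₁₂ m₂₁ m₂₂ : Carrier
  open Mat public

  record _≈ₘ_ (P Q : Mat) : Set ℓ where
    constructor mat≈
    field
      ≈₁₁ : m₁₁ P ≈ m₁₁ Q
      ≈₁₂ : m₁₂ P ≈ m₁₂ Q
      ≈₂₁ : m₂₁ P ≈ m₂₁ Q
      ≈₂₂ : m₂₂ P ≈ m₂₂ Q

  infixl 7 _·_
  infix 4 _≈ₘ_

  _·_ : Mat → Mat → Mat
  mat a b c d · mat a' b' c' d' =
    mat (a * a' + b * c') (a * b' + b * d') (c * a' + d * c') (c * b' + d * d')

  identity : Mat
  identity = mat 1# 0# 0# 1#

  mapₘ : (Carrier → Carrier) → Mat → Mat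
  mapₘ f (mat a b c d) = mat (f a) (f b) (f c) (f d)

  trace det : Mat → Carrier
  trace (mat a b c d) = a + d
  det   (mat a b c d) = a * d - b * c

  ≈ₘ-trans : ∀ {P Q R} → P ≈ₘ Q → Q ≈ₘ R → P ≈ₘ R
  ≈ₘ-trans (mat≈ p₁ p₂ p₃ p₄) (mat≈ q₁ q₂ q₃ q₄) = mat≈ (trans p₁ q₁) (trans p₂ q₂) (trans p₃ q₃) (trans p₄ q₄)

  ·-congʳ : ∀ {P Q R} → P ≈ₘ Q → P · R ≈ₘ Q · R
  ·-congʳ (mat≈ p₁ p₂ p₃ p₄) = mat≈ (row p₁ p₂) (row p₁ p₂) (row p₃ p₄) (row p₃ p₄)
    where
    row : ∀ {a b a' b' x y} → a ≈ a' → b ≈ b' → a * x + b * y ≈ a' * x + b' * y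
    row p q = +-cong (*-congʳ p) (*-congʳ q)

  ·-assoc : ∀ P Q R → (P · Q) · R ≈ₘ P · (Q · R)
  ·-assoc P Q R = mat≈ (row (m₁₁ P) (m₁₂ P)) (row (m₁₁ P) (m₁₂ P)) (row (m₂₁ P) (m₂₂ P)) (row (m₂₁ P) (m₂₂ P))
    where
    row : ∀ p q {a b c d x y} → (p * a + q * c) * x + (p * b + q * d) * y ≈ p * (a * x + b * y) + q *
        (c * x + d * y)
    row p q {a} {b} {c} {d} {x} {y} = solve 8 (λ p q a b c d x y →
      (p :* a :+ q :* c) :* x :+ (p :* b :+ q :* d) :* y := p :* (a :* x :+ b :* y) :+ q :* (c :* x :+ d :* y))
      refl p q a b c d x y

  mapₘ-· : ∀ P Q → mapₘ σ (P · Q) ≈ₘ mapₘ σ P · mapₘ σ Q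
  mapₘ-· P Q = mat≈ entry entry entry entry
    where
    entry : ∀ {a b x y} → σ (a * x + b * y) ≈ σ a * σ x + σ b * σ y
    entry = trans (σ.+-homo _ _) (+-cong (σ.*-homo _ _) (σ.*-homo _ _))

  mapₘ-cong : ∀ {P Q} → P ≈ₘ Q → mapₘ σ P ≈ₘ mapₘ σ Q
  mapₘ-cong (mat≈ p₁ p₂ p₃ p₄) = mat≈ (σ.⟦⟧-cong p₁) (σ.⟦⟧-cong p₂) (σ.⟦⟧-cong p₃) (σ.⟦⟧-cong p₄)

  -- The twisted product σ^(k-1)(M) ⋯ σ(M) M; for k = n it is the M' of the overview.
  power : ℕ → Mat → Mat
  power zero    M = identity
  power (suc k) M = mapₘ σ (power k M) · M

  -- Splits the twisted product at its left end. Together with the recursion at the right end and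
  -- σⁿ(M) = M it gives σ(M') M = M M', which is `conjugate` below.
  power-sucˡ : ∀ k M → power (suc k) M ≈ₘ mapₘ (iter σ k) M · power k M
  power-sucˡ zero M = mat≈
    (trans (+-cong (*-congʳ σ.1#-homo) (*-congʳ σ.0#-homo)) (eq _ _ _))
    (trans (+-cong (*-congʳ σ.1#-homo) (*-congʳ σ.0#-homo)) (eq' _ _ _))
    (trans (+-cong (*-congʳ σ.0#-homo) (*-congʳ σ.1#-homo)) (trans (+-comm _ _) (eq _ _ _)))
    (trans (+-cong (*-congʳ σ.0#-homo) (*-congʳ σ.1#-homo)) (trans (+-comm _ _) (eq' _ _ _)))
    where
    eq : ∀ x y z → 1# * x + 0# * y ≈ x * 1# + z * 0#
    eq = solve 3 (λ x y z → one :* x :+ nil :* y := x :* one :+ z :* nil) refl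
    eq' : ∀ x y z → 1# * x + 0# * y ≈ z * 0# + x * 1#
    eq' = solve 3 (λ x y z → one :* x :+ nil :* y := z :* nil :+ x :* one) refl
  power-sucˡ (suc k) M =
    ≈ₘ-trans (·-congʳ (mapₘ-cong (power-sucˡ k M)))
    (≈ₘ-trans (·-congʳ (mapₘ-· (mapₘ (iter σ k) M) (power k M))) (·-assoc _ _ _))

  module _ {n M} (fix : mapₘ (iter σ n) M ≈ₘ M)
           (cancel : ∀ {x y} → x * det M ≈ y * det M → x ≈ y) where
    private
      P = power n M
      P' = mapₘ σ P

      conjugate : P' · M ≈ₘ M · P
      conjugate = ≈ₘ-trans (power-sucˡ n M) (·-congʳ fix)

      -- trace (X · adj M)
      trace-adj : ∀ X N → X ≈ₘ N →
        (m₁₁ X * m₂₂ M - m₁₂ X * m₂₁ M) + (m₂₂ X * m₁₁ M - m₂₁ X * m₁₂ M) ≈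
        (m₁₁ N * m₂₂ M - m₁₂ N * m₂₁ M) + (m₂₂ N * m₁₁ M - m₂₁ N * m₁₂ M)
      trace-adj X N (mat≈ p₁ p₂ p₃ p₄) =
        +-cong (+-cong (*-congʳ p₁) (-‿cong (*-congʳ p₂))) (+-cong (*-congʳ p₄) (-‿cong (*-congʳ p₃)))

      det-cong : ∀ {X N} → X ≈ₘ N → det X ≈ det N
      det-cong (mat≈ p₁ p₂ p₃ p₄) = +-cong (*-cong p₁ p₄) (-‿cong (*-cong p₂ p₃))

    -- Both sides of `conjugate` are multiplied by the adjugate of M before taking traces. As M
    -- adj(M) = det M, the left side gives trace σ(P) · det M, and cyclicity of the trace turns the
    -- right side into trace P · det M; then det M is cancelled.
    trace-power-fixed : σ (trace P) ≈ trace P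
    trace-power-fixed = trans (σ.+-homo _ _) (cancel (begin
      (m₁₁ P' + m₂₂ P') * det M   ≈⟨ lhs _ _ _ _ _ _ _ _ ⟩
      _                           ≈⟨ trace-adj (P' · M) (M · P) conjugate ⟩
      _                           ≈⟨ rhs _ _ _ _ _ _ _ _ ⟨
      trace P * det M             ∎))
      where
      lhs : ∀ p q r s a b c d → (p + s) * (a * d - b * c) ≈
        ((p * a + q * c) * d - (p * b + q * d) * c) + ((r * b + s * d) * a - (r * a + s * c) * b)
      lhs = solve 8 (λ p q r s a b c d → (p :+ s) :* (a :* d :- b :* c) :=
        ((p :* a :+ q :* c) :* d :- (p :* b :+ q :* d) :* c) :+ ((r :* b :+ s :* d) :* a :-
            (r :* a :+ s :* c) :* b)) refl
      rhs : ∀ p q r s a b c d → (p + s) * (a * d - b * c) ≈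
        ((a * p + b * r) * d - (a * q + b * s) * c) + ((c * q + d * s) * a - (c * p + d * r) * b)
      rhs = solve 8 (λ p q r s a b c d → (p :+ s) :* (a :* d :- b :* c) :=
        ((a :* p :+ b :* r) :* d :- (a :* q :+ b :* s) :* c) :+ ((c :* q :+ d :* s) :* a :-
            (c :* p :+ d :* r) :* b)) refl

    det-power-fixed : σ (det P) ≈ det P
    det-power-fixed = trans σ-det (cancel (begin
      det P' * det M   ≈⟨ det-· _ _ _ _ _ _ _ _ ⟩
      det (P' · M)     ≈⟨ det-cong conjugate ⟩
      det (M · P)      ≈⟨ det-· _ _ _ _ _ _ _ _ ⟨
      det M * det P    ≈⟨ *-comm _ _ ⟩
      det P * det M    ∎))
      where
      σ-det : σ (det P) ≈ det P'
      σ-det = trans (σ.+-homo _ _) (+-cong (σ.*-homo _ _) (trans (σ.-‿homo _) (-‿cong (σ.*-homo _ _))))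
      det-· : ∀ p q r s a b c d → (p * s - q * r) * (a * d - b * c) ≈
        (p * a + q * c) * (r * b + s * d) - (p * b + q * d) * (r * a + s * c)
      det-· = solve 8 (λ p q r s a b c d → (p :* s :- q :* r) :* (a :* d :- b :* c) :=
        (p :* a :+ q :* c) :* (r :* b :+ s :* d) :- (p :* b :+ q :* d) :* (r :* a :+ s :* c)) refl

module MatrixAction
  {c ℓ c' ℓ'} (K : CommutativeRing c ℓ) (S : CommutativeRing c' ℓ')
  {ι : CommutativeRing.Carrier K → CommutativeRing.Carrier S}
  (ι-hom : IsRingHomomorphism (CommutativeRing.rawRing K) (CommutativeRing.rawRing S) ι)
  {σ : CommutativeRing.Carrier K → CommutativeRing.Carrier K}
  (σ-hom : IsRingHomomorphism (CommutativeRing.rawRing K) (CommutativeRing.rawRing K) σ)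
  {τ : CommutativeRing.Carrier S → CommutativeRing.Carrier S}
  (τ-hom : IsRingHomomorphism (CommutativeRing.rawRing S) (CommutativeRing.rawRing S) τ)
  (τι≈ισ : ∀ k → CommutativeRing._≈_ S (τ (ι k)) (ι (σ k)))
  where
  open CommutativeRing S hiding (zero)
  open IntegerSolver S
  open import Relation.Binary.Reasoning.Setoid setoid
  open Matrices K σ-hom
  open Norm S τ-hom
  private
    module K = CommutativeRing K
    module ι = IsRingHomomorphism ι-hom
    module τ = IsRingHomomorphism τ-hom

    row : K.Carrier → K.Carrier → Carrier → Carrier → Carrier
    row p q X x = ι p * X + ι q * x

  -- The target vector (X', x') is kept apart from the source (X, x) because the eigenvector is
  -- semilinear: one application of M lands on b (τ X, τ x), and only after n steps does a vector
  -- fixed by τⁿ come back to itself.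
  record Eigen (P : Mat) (Y X x X' x' : Carrier) : Set ℓ' where
    constructor eigen
    field
      upper : row (m₁₁ P) (m₁₂ P) X x ≈ Y * X'
      lower : row (m₂₁ P) (m₂₂ P) X x ≈ Y * x'

  -- In the product σ(M_k) M, with M_k the k-th twisted power, M acts first and produces b τ(w).
  -- Then σ(M_k) acts on τ(w) as the τ-image of M_k acting on w, to which the induction hypothesis
  -- applies.
  eigen-power : ∀ {M b X x} → Eigen M b X x (τ X) (τ x) →
                ∀ k → Eigen (power k M) (norm k b) X x (iter τ k X) (iter τ k x)
  eigen-power {X = X} {x} _ zero = eigen
    (trans (+-cong (*-congʳ ι.1#-homo) (*-congʳ ι.0#-homo)) (solve 2 (λ X x → one :* X :+ nil :* x
        := one :* X) refl X x))
    (trans (+-cong (*-congʳ ι.0#-homo) (*-congʳ ι.1#-homo)) (solve 2 (λ X x → nil :* X :+ one :* x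
        := one :* x) refl X x))
  eigen-power {mat m₁ m₂ m₃ m₄} {b} {X} {x} e@(eigen up low) (suc k) with eigen-power e k
  ... | eigen up' low' = eigen (step up') (step low')
    where
    step : ∀ {p q z} → row p q X x ≈ norm k b * z →
           row (σ p K.* m₁ K.+ σ q K.* m₃) (σ p K.* m₂ K.+ σ q K.* m₄) X x ≈ b * τ (norm k b) * τ z
    step {p} {q} {z} h = begin
      row (σ p K.* m₁ K.+ σ q K.* m₃) (σ p K.* m₂ K.+ σ q K.* m₄) X x
        ≈⟨ +-cong (*-congʳ ι-entry) (*-congʳ ι-entry) ⟩
      (ι (σ p) * ι m₁ + ι (σ q) * ι m₃) * X + (ι (σ p) * ι m₂ + ι (σ q) * ι m₄) * x
        ≈⟨ solve 8 (λ p q m₁ m₂ m₃ m₄ X x →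
             (p :* m₁ :+ q :* m₃) :* X :+ (p :* m₂ :+ q :* m₄) :* x :=
             p :* (m₁ :* X :+ m₂ :* x) :+ q :* (m₃ :* X :+ m₄ :* x)) refl _ _ _ _ _ _ _ _ ⟩
      ι (σ p) * row m₁ m₂ X x + ι (σ q) * row m₃ m₄ X x
        ≈⟨ +-cong (*-cong (sym (τι≈ισ p)) up) (*-cong (sym (τι≈ισ q)) low) ⟩
      τ (ι p) * (b * τ X) + τ (ι q) * (b * τ x)
        ≈⟨ solve 5 (λ p q b X x → p :* (b :* X) :+ q :* (b :* x) := b :* (p :* X :+ q :* x)) refl _ _ _ _ _ ⟩
      b * (τ (ι p) * τ X + τ (ι q) * τ x)
        ≈⟨ *-congˡ (+-cong (τ.*-homo _ _) (τ.*-homo _ _)) ⟨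
      b * (τ (ι p * X) + τ (ι q * x))
        ≈⟨ *-congˡ (τ.+-homo _ _) ⟨
      b * τ (row p q X x)
        ≈⟨ *-congˡ (trans (τ.⟦⟧-cong h) (τ.*-homo _ _)) ⟩
      b * (τ (norm k b) * τ z)
        ≈⟨ *-assoc _ _ _ ⟨
      b * τ (norm k b) * τ z ∎
      where
      ι-entry : ∀ {a b c d} → ι (a K.* b K.+ c K.* d) ≈ ι a * ι b + ι c * ι d
      ι-entry = trans (ι.+-homo _ _) (+-cong (ι.*-homo _ _) (ι.*-homo _ _))

  -- The coordinate X is eliminated from the two eigenvector equations: p - Y times the second minus
  -- r times the first. Since R may have zero divisors, the factor x stays in the conclusion.
  cayley-hamilton : ∀ {P Y X x} → Eigen P Y X x X x → (Y * Y - ι (trace P) * Y + ι (det P)) * x ≈ 0#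
  cayley-hamilton {mat p q r s} {Y} {X} {x} (eigen up low) = begin
    (Y * Y - ι (p K.+ s) * Y + ι (p K.* s K.- q K.* r)) * x
      ≈⟨ *-congʳ (+-cong (+-congˡ (-‿cong (*-congʳ (ι.+-homo _ _)))) ι-det) ⟩
    (Y * Y - (ι p + ι s) * Y + (ι p * ι s - ι q * ι r)) * x
      ≈⟨ solve 7 (λ Y p q r s X x →
           (Y :* Y :- (p :+ s) :* Y :+ (p :* s :- q :* r)) :* x :=
           (p :- Y) :* (r :* X :+ s :* x :- Y :* x) :- r :* (p :* X :+ q :* x :- Y :* X)) refl _ _ _ _ _ _ _ ⟩
    (ι p - Y) * (row r s X x - Y * x) - ι r * (row p q X x - Y * X)
      ≈⟨ +-cong (*-congˡ (vanish low)) (-‿cong (*-congˡ (vanish up))) ⟩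
    (ι p - Y) * 0# - ι r * 0#
      ≈⟨ solve 2 (λ r p → p :* nil :- r :* nil := nil) refl _ _ ⟩
    0# ∎
    where
    ι-det : ι (p K.* s K.- q K.* r) ≈ ι p * ι s - ι q * ι r
    ι-det = trans (ι.+-homo _ _) (+-cong (ι.*-homo _ _) (trans (ι.-‿homo _) (-‿cong (ι.*-homo _ _))))
    vanish : ∀ {u v} → u ≈ v → u - v ≈ 0#
    vanish e = trans (+-congʳ e) (-‿inverseʳ _)

-- Binomial divisibility and finite counting.

prime∤! : ∀ {p m} → Prime p → m ℕ.< p → ¬ (p ∣ m !)
prime∤! {p} {zero}  pr _   p∣1 = >⇒∤ (ℕ.nonTrivial⇒n>1 p {{prime⇒nonTrivial pr}}) p∣1
prime∤! {m = suc m} pr m<p p∣  with euclidsLemma (suc m) (m !) pr p∣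
... | inj₁ p∣m  = >⇒∤ m<p p∣m
... | inj₂ p∣m! = prime∤! pr (ℕₚ.<-trans (ℕₚ.n<1+n m) m<p) p∣m!

nCk*k![n∸k]!≡n! : ∀ {n k} → k ℕ.≤ n → (n C k) ℕ.* (k ! ℕ.* (n ℕ.∸ k) !) ≡ n !
nCk*k![n∸k]!≡n! {n} {k} k≤n = ≡.trans
  (≡.cong (ℕ._* (k ! ℕ.* (n ℕ.∸ k) !)) (nCk≡n!/k![n-k]! k≤n))
  (m/n*n≡m {{ℕₚ._!*_!≢0 k (n ℕ.∸ k)}} (k![n∸k]!∣n! k≤n))

prime∣C : ∀ {p k} → Prime p → 0 ℕ.< k → k ℕ.< p → p ∣ p C k
prime∣C {p@(suc p-1)} {k@(suc k-1)} pr _ k<p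
  with euclidsLemma (p C k) (k ! ℕ.* (p ℕ.∸ k) !) pr
         (≡.subst (p ∣_) (≡.sym (nCk*k![n∸k]!≡n! (ℕₚ.<⇒≤ k<p))) (m∣m*n (p-1 !)))
... | inj₁ p∣C = p∣C
... | inj₂ p∣k!l! with euclidsLemma (k !) ((p ℕ.∸ k) !) pr p∣k!l!
...   | inj₁ p∣k! = contradiction p∣k! (prime∤! pr k<p)
...   | inj₂ p∣l! = contradiction p∣l! (prime∤! pr (ℕ.s≤s (ℕₚ.m∸n≤m p-1 k-1)))

-- If each of the M distinct values agreed with one of the L listed ones, pigeonhole would identify
-- two of them. The list `s` may contain repetitions. This serves the counting of roots, of values
-- and of spans, and the choice of γ.
avoid : ∀ {a r} {A : Set a} {_~_ : A → A → Set r} → Decidable _~_ →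
        (∀ {x y} → x ~ y → y ~ x) → (∀ {x y z} → x ~ y → y ~ z → x ~ z) →
        ∀ {M L} (f : Fin M → A) → (∀ i j → f i ~ f j → i ≡ j) → (s : Fin L → A) → L ℕ.< M →
        ∃ λ i → ∀ j → ¬ (f i ~ s j)
avoid {_~_ = _~_} _≟_ sym trans f inj s L<M
  with Finₚ.¬∀⟶∃¬ _ _ (λ i → Finₚ.any? (λ j → f i ≟ s j)) covered-contra
  where
  covered-contra : ¬ (∀ i → ∃ λ j → f i ~ s j)
  covered-contra covered with Finₚ.pigeonhole L<M (proj₁ ∘ covered)
  ... | i , i' , i<i' , eq = Finₚ.<⇒≢ i<i' (inj i i'
        (trans (proj₂ (covered i)) (sym (≡.subst (λ j → f i' ~ s j) (≡.sym eq) (proj₂ (covered i'))))))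
... | i , missed = i , λ j e → missed (j , e)

module _ {c ℓ} (M : CommutativeMonoid c ℓ) where
  open CommutativeMonoid M using (Carrier; _≈_; sym; trans; refl; reflexive; setoid)
  open import Algebra.Properties.CommutativeMonoid.Sum M using (sum; sum-permute; sum-cong-≋)

  -- Stated for a commutative monoid so that it covers both translation by 1 in the additive group
  -- and multiplication by a unit among the nonzero elements.
  sum-bijection : ∀ {m} (f : Fin m → Carrier) → (∀ i j → f i ≈ f j → i ≡ j) →
    (g h : Carrier → Carrier) → (∀ {x y} → x ≈ y → g x ≈ g y) → (∀ {x y} → x ≈ y → h x ≈ h y) →
    (∀ x → g (h x) ≈ x) → (∀ x → h (g x) ≈ x) →
    (∀ i → ∃ λ j → f j ≈ g (f i)) → (∀ i → ∃ λ j → f j ≈ h (f i)) →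
    sum f ≈ sum (g ∘ f)
  sum-bijection f inj g h g-cong h-cong gh hg g-index h-index =
    trans (sum-permute f π) (sum-cong-≋ (proj₂ ∘ g-index))
    where
    π : Permutation′ _
    π = permutation (proj₁ ∘ g-index) (proj₁ ∘ h-index)
      (λ i → inj _ _ (trans (proj₂ (g-index _)) (trans (g-cong (proj₂ (h-index i))) (gh (f i)))))
      (λ i → inj _ _ (trans (proj₂ (h-index _)) (trans (h-cong (proj₂ (g-index i))) (hg (f i)))))

-- Finite fields: decidability, Fermat's identity, characteristic, Frobenius.

module FiniteField {c ℓ} (K : CommutativeRing c ℓ) (isField : IsField K) {N} (size : HasSize K N) where
  open CommutativeRing K hiding (zero) renaming (Carrier to A)
  open import Relation.Binary.Reasoning.Setoid setoid
  open import Algebra.Properties.Ring ring using () renaming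
      (x∙y⁻¹≈ε⇒x≈y to x-y≈0⇒x≈y; x≈y⇒x∙y⁻¹≈ε to x≈y⇒x-y≈0)
  open IntegerSolver K
  open import Algebra.Properties.Semiring.Exp semiring using (_^_)
  open import Algebra.Properties.Semiring.Mult semiring
    using (×1-homo-*; ×-assocˡ; ×-congʳ; ×-congˡ; ×-homo-1) renaming (_×_ to _×ᵤ_)

  element : Fin N → A
  element = proj₁ size

  element-injective : ∀ i j → element i ≈ element j → i ≡ j
  element-injective = proj₂ (proj₂ size)

  index : A → Fin N
  index x = proj₁ (proj₁ (proj₂ size) x)

  element-index : ∀ x → element (index x) ≈ x
  element-index x = proj₂ (proj₁ (proj₂ size) x)

  infix 4 _≟_

  _≟_ : Decidable _≈_
  x ≟ y = map′ (λ e → trans (sym (element-index x)) (trans (reflexive (≡.cong element e)) (element-index y)))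
               (λ e → element-injective _ _ (trans (element-index x) (trans e (sym (element-index y)))))
               (index x Fin.≟ index y)

  1≉0 : ¬ 1# ≈ 0#
  1≉0 = proj₁ isField

  cancel-nonzero : ∀ {x y} → ¬ y ≈ 0# → x * y ≈ 0# → x ≈ 0#
  cancel-nonzero {x} {y} y≉0 xy≈0 with proj₂ isField y y≉0
  ... | z , yz≈1 = begin
    x            ≈⟨ *-identityʳ x ⟨
    x * 1#       ≈⟨ *-congˡ yz≈1 ⟨
    x * (y * z)  ≈⟨ *-assoc x y z ⟨
    x * y * z    ≈⟨ *-congʳ xy≈0 ⟩
    0# * z       ≈⟨ zeroˡ z ⟩
    0#           ∎

  no-zero-divisors : ∀ x y → x * y ≈ 0# → x ≈ 0# ⊎ y ≈ 0#
  no-zero-divisors x y e with y ≟ 0#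
  ... | yes y≈0 = inj₂ y≈0
  ... | no  y≉0 = inj₁ (cancel-nonzero y≉0 e)

  *-nonzero : ∀ {x y} → ¬ x ≈ 0# → ¬ y ≈ 0# → ¬ x * y ≈ 0#
  *-nonzero x≉0 y≉0 e = x≉0 (cancel-nonzero y≉0 e)

  *-cancelʳ : ∀ {x y z} → ¬ z ≈ 0# → x * z ≈ y * z → x ≈ y
  *-cancelʳ {x} {y} {z} z≉0 e = x-y≈0⇒x≈y x y (cancel-nonzero z≉0 (begin
    (x - y) * z      ≈⟨ solve 3 (λ x y z → (x :- y) :* z := x :* z :- y :* z) refl x y z ⟩
    x * z - y * z    ≈⟨ x≈y⇒x-y≈0 e ⟩
    0#               ∎))

  fixed-inverse : ∀ {σ x y} → IsRingHomomorphism rawRing rawRing σ → x * y ≈ 1# → σ x ≈ x → σ y ≈ y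
  fixed-inverse {σ} {x} {y} hom xy≈1 fix = begin
    σ y              ≈⟨ *-identityˡ _ ⟨
    1# * σ y         ≈⟨ *-congʳ xy≈1 ⟨
    x * y * σ y      ≈⟨ solve 3 (λ x y z → x :* y :* z := x :* z :* y) refl x y (σ y) ⟩
    x * σ y * y      ≈⟨ *-congʳ (*-congʳ fix) ⟨
    σ x * σ y * y    ≈⟨ *-congʳ (σ.*-homo x y) ⟨
    σ (x * y) * y    ≈⟨ *-congʳ (trans (σ.⟦⟧-cong xy≈1) σ.1#-homo) ⟩
    1# * y           ≈⟨ *-identityˡ y ⟩
    y                ∎
    where module σ = IsRingHomomorphism hom

  pow≡^ : ∀ x m → pow K x m ≡ x ^ m
  pow≡^ x zero    = ≡.refl
  pow≡^ x (suc m) = ≡.cong (x *_) (pow≡^ x m)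

  -- Translation by 1 permutes K, so the sum s of all elements satisfies s = s + N · 1.
  N×1≈0 : N ×ᵤ 1# ≈ 0#
  N×1≈0 = begin
    N ×ᵤ 1#                   ≈⟨ +-identityˡ _ ⟨
    0# + N ×ᵤ 1#              ≈⟨ +-congʳ (-‿inverseˡ s) ⟨
    - s + s + N ×ᵤ 1#         ≈⟨ +-assoc _ _ _ ⟩
    - s + (s + N ×ᵤ 1#)       ≈⟨ +-congˡ (+-congˡ (sum-replicate N)) ⟨
    - s + (s + sum {N} (λ _ → 1#)) ≈⟨ +-congˡ (∑-distrib-+ element (λ _ → 1#)) ⟨
    - s + sum (λ i → element i + 1#) ≈⟨ +-congˡ shift ⟨
    - s + s                   ≈⟨ -‿inverseˡ s ⟩
    0#                        ∎
    where
    open import Algebra.Properties.CommutativeMonoid.Sum +-commutativeMonoid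
    s = sum element
    shift : s ≈ sum (λ i → element i + 1#)
    shift = sum-bijection +-commutativeMonoid element element-injective (_+ 1#) (_- 1#) +-congʳ +-congʳ
      (λ x → solve 1 (λ x → x :- one :+ one := x) refl x)
      (λ x → solve 1 (λ x → x :+ one :- one := x) refl x)
      (λ i → _ , element-index _) (λ i → _ , element-index _)

  record NonzeroEnumeration (m : ℕ) : Set (c ⊔ ℓ) where
    field
      unit           : Fin m → A
      unit≉0         : ∀ i → ¬ unit i ≈ 0#
      unit-injective : ∀ i j → unit i ≈ unit j → i ≡ j
      unit-index     : ∀ y → ¬ y ≈ 0# → ∃ λ i → unit i ≈ y

  nonzeros : ∃ λ m → suc m ≡ N × NonzeroEnumeration m
  nonzeros = helper N ≡.refl
    where
    helper : ∀ k → k ≡ N → ∃ λ m → suc m ≡ N × NonzeroEnumeration m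
    helper zero    0≡N = contradiction (≡.subst Fin (≡.sym 0≡N) (index 0#)) λ()
    helper (suc m) ≡.refl = m , ≡.refl , record
      { unit = λ i → element (punchIn (index 0#) i)
      ; unit≉0 = λ i e → Finₚ.punchInᵢ≢i (index 0#) i
          (element-injective _ _ (trans e (sym (element-index 0#))))
      ; unit-injective = λ i j e → Finₚ.punchIn-injective _ i j (element-injective _ _ e)
      ; unit-index = λ y y≉0 →
          let 0≢y = λ e → y≉0 (trans (sym (element-index y))
                            (trans (reflexive (≡.cong element (≡.sym e))) (element-index 0#)))
          in punchOut 0≢y
           , trans (reflexive (≡.cong element (Finₚ.punchIn-punchOut 0≢y))) (element-index y) }

  -- Multiplication by x permutes the nonzero elements, so their product P satisfies P ≈ x^(N-1) P.
  x^N≈x : ∀ x → pow K x N ≈ x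
  x^N≈x x = helper (proj₁ (proj₂ nonzeros)) (proj₂ (proj₂ nonzeros))
    where
    helper : ∀ {m} → suc m ≡ N → NonzeroEnumeration m → pow K x N ≈ x
    helper {m} ≡.refl enumeration with x ≟ 0#
    ... | yes x≈0 = trans (*-congʳ x≈0) (trans (zeroˡ _) (sym x≈0))
    ... | no  x≉0 = trans (*-congˡ x^m≈1) (*-identityʳ x)
      where
      open NonzeroEnumeration enumeration
      open import Algebra.Properties.CommutativeMonoid.Sum *-commutativeMonoid
        renaming (sum to product)
      x⁻¹ = proj₁ (proj₂ isField x x≉0)
      xx⁻¹≈1 = proj₂ (proj₂ isField x x≉0)
      x⁻¹≉0 : ¬ x⁻¹ ≈ 0#
      x⁻¹≉0 e = 1≉0 (trans (sym xx⁻¹≈1) (trans (*-congˡ e) (zeroʳ x)))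

      product-nonzero : ∀ {k} (f : Fin k → A) → (∀ i → ¬ f i ≈ 0#) → ¬ product f ≈ 0#
      product-nonzero {zero}  f _ = 1≉0
      product-nonzero {suc k} f h = *-nonzero (h zero) (product-nonzero (f ∘ suc) (h ∘ suc))

      product-* : ∀ {k} (f : Fin k → A) → product (λ i → x * f i) ≈ pow K x k * product f
      product-* {zero}  f = sym (*-identityˡ 1#)
      product-* {suc k} f = trans (*-congˡ (product-* (f ∘ suc)))
        (solve 4 (λ x f p q → x :* f :* (p :* q) := x :* p :* (f :* q)) refl _ _ _ _)

      x^m≈1 : pow K x m ≈ 1#
      x^m≈1 = *-cancelʳ (product-nonzero unit unit≉0) (begin
        pow K x m * product unit          ≈⟨ product-* unit ⟨
        product (λ i → x * unit i)        ≈⟨ permuted ⟨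
        product unit                      ≈⟨ *-identityˡ _ ⟨
        1# * product unit                 ∎)
        where
        permuted = sum-bijection *-commutativeMonoid unit unit-injective (x *_) (x⁻¹ *_) *-congˡ *-congˡ
          (λ y → trans (sym (*-assoc _ _ _)) (trans (*-congʳ xx⁻¹≈1) (*-identityˡ y)))
          (λ y → trans (sym (*-assoc _ _ _)) (trans (*-congʳ (trans (*-comm _ _) xx⁻¹≈1)) (*-identityˡ y)))
          (λ i → unit-index _ (*-nonzero x≉0 (unit≉0 i)))
          (λ i → unit-index _ (*-nonzero x⁻¹≉0 (unit≉0 i)))

  -- The image of p^m in K is the m-th power of the image of p and vanishes by `N×1≈0`; without zero
  -- divisors the image of p itself vanishes.
  characteristic : ∀ {p m} → N ≡ p ℕ.^ m → p ×ᵤ 1# ≈ 0#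
  characteristic {p} {m} N≡p^m = vanish m (trans (reflexive (≡.cong (_×ᵤ 1#) (≡.sym N≡p^m))) N×1≈0)
    where
    vanish : ∀ m → (p ℕ.^ m) ×ᵤ 1# ≈ 0# → p ×ᵤ 1# ≈ 0#
    vanish zero    e = contradiction (trans (sym (×-homo-1 1#)) e) 1≉0
    vanish (suc m) e with no-zero-divisors _ _ (trans (sym (×1-homo-* p (p ℕ.^ m))) e)
    ... | inj₁ p≈0 = p≈0
    ... | inj₂ e'  = vanish m e'

  module Frobenius {p} (pr : Prime p) (p×1≈0 : p ×ᵤ 1# ≈ 0#) where
    open import Algebra.Properties.Semiring.Mult semiring using (×-assoc-*)
    open import Algebra.Properties.CommutativeSemiring.Binomial commutativeSemiring
    open import Algebra.Properties.CommutativeSemiring.Exp commutativeSemiring using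
        (^-distrib-*; ^-congˡ; ^-assocʳ)
    open import Algebra.Properties.CommutativeMonoid.Sum +-commutativeMonoid
      using (sum; sum-init-last; sum-cong-≋; sum-replicate-zero)

    ∣⇒×≈0 : ∀ {k} x → p ∣ k → k ×ᵤ x ≈ 0#
    ∣⇒×≈0 {k} x (divides r ≡.refl) = begin
      (r ℕ.* p) ×ᵤ x          ≡⟨ ≡.cong (_×ᵤ x) (ℕₚ.*-comm r p) ⟩
      (p ℕ.* r) ×ᵤ x          ≈⟨ ×-assocˡ x p r ⟨
      p ×ᵤ (r ×ᵤ x)           ≈⟨ ×-congʳ p (*-identityˡ _) ⟨
      p ×ᵤ (1# * (r ×ᵤ x))    ≈⟨ ×-assoc-* p 1# _ ⟨
      (p ×ᵤ 1#) * (r ×ᵤ x)    ≈⟨ *-congʳ p×1≈0 ⟩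
      0# * (r ×ᵤ x)           ≈⟨ zeroˡ _ ⟩
      0#                      ∎

    ^p-homo-+ : ∀ x y → (x + y) ^ p ≈ x ^ p + y ^ p
    ^p-homo-+ x y = helper p ≡.refl
      where
      helper : ∀ r → r ≡ p → (x + y) ^ r ≈ x ^ r + y ^ r
      helper zero 0≡p = contradiction (≡.subst Prime (≡.sym 0≡p) pr) λ ()
      helper r@(suc r-1) ≡.refl = begin
        (x + y) ^ r                                    ≈⟨ theorem r x y ⟩
        sum (binomialTerm x y r)                       ≈⟨ +-congˡ (sum-init-last (binomialTerm x y r ∘ suc)) ⟩
        binomialTerm x y r zero + (sum middle + last)  ≈⟨ +-cong first≈ (+-cong middle≈0 last≈) ⟩
        y ^ r + (0# + x ^ r)                           ≈⟨ solve 2 (λ a b → b :+ (nil :+ a)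
            := a :+ b) refl (x ^ r) (y ^ r) ⟩
        x ^ r + y ^ r                                  ∎
        where
        middle : Fin r-1 → A
        middle j = binomialTerm x y r (suc (inject₁ j))
        last = binomialTerm x y r (suc (fromℕ r-1))

        first≈ : binomialTerm x y r zero ≈ y ^ r
        first≈ = trans (×-homo-1 _) (*-identityˡ _)

        last≈ : last ≈ x ^ r
        last≈ = go (≡.cong suc (Finₚ.toℕ-fromℕ r-1))
          where
          go : ∀ {k} → k ≡ r → (r C k) ×ᵤ (x ^ k * y ^ (r ℕ.∸ k)) ≈ x ^ r
          go ≡.refl = begin
            (r C r) ×ᵤ (x ^ r * y ^ (r ℕ.∸ r))  ≈⟨ ×-congˡ (nCn≡1 r) ⟩
            1 ×ᵤ (x ^ r * y ^ (r ℕ.∸ r))        ≈⟨ ×-homo-1 _ ⟩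
            x ^ r * y ^ (r ℕ.∸ r)               ≡⟨ ≡.cong (λ k → x ^ r * y ^ k) (ℕₚ.n∸n≡0 r) ⟩
            x ^ r * 1#                          ≈⟨ *-identityʳ _ ⟩
            x ^ r                               ∎

        middle≈0 : sum middle ≈ 0#
        middle≈0 = trans (sum-cong-≋ {x = middle} {y = λ _ → 0#} (λ j → ∣⇒×≈0 _ (prime∣C pr (ℕ.s≤s ℕ.z≤n)
            (ℕ.s≤s (≡.subst (ℕ._< r-1) (≡.sym (Finₚ.toℕ-inject₁ j)) (Finₚ.toℕ<n j))))))
          (sum-replicate-zero r-1)

    ^p^-homo-+ : ∀ e x y → (x + y) ^ (p ℕ.^ e) ≈ x ^ (p ℕ.^ e) + y ^ (p ℕ.^ e)
    ^p^-homo-+ zero    x y = solve 2 (λ x y → (x :+ y) :* one := x :* one :+ y :* one) refl x y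
    ^p^-homo-+ (suc e) x y = begin
      (x + y) ^ (p ℕ.* p ℕ.^ e)                   ≈⟨ ^-assocʳ (x + y) p _ ⟨
      ((x + y) ^ p) ^ (p ℕ.^ e)                   ≈⟨ ^-congˡ (p ℕ.^ e) (^p-homo-+ x y) ⟩
      (x ^ p + y ^ p) ^ (p ℕ.^ e)                 ≈⟨ ^p^-homo-+ e _ _ ⟩
      (x ^ p) ^ (p ℕ.^ e) + (y ^ p) ^ (p ℕ.^ e)   ≈⟨ +-cong (^-assocʳ x p _) (^-assocʳ y p _) ⟩
      x ^ (p ℕ.* p ℕ.^ e) + y ^ (p ℕ.* p ℕ.^ e)   ∎

    frobenius-isRingHomomorphism : ∀ e → IsRingHomomorphism rawRing rawRing (λ x → pow K x (p ℕ.^ e))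
    frobenius-isRingHomomorphism e = record
      { isSemiringHomomorphism = record
        { isNearSemiringHomomorphism = record
          { +-isMonoidHomomorphism = record
            { isMagmaHomomorphism = record
              { isRelHomomorphism = record { cong = pow-cong }
              ; homo = pow-+ }
            ; ε-homo = pow-0 }
          ; *-homo = pow-* }
        ; 1#-homo = 1^ (p ℕ.^ e) }
      ; -‿homo = λ x → +-inverseˡ-unique _ _ (trans (sym (pow-+ (- x) x)) (trans (pow-cong
          (-‿inverseˡ x)) pow-0)) }
      where
      open import Algebra.Properties.Ring ring using (+-inverseˡ-unique; x+x≈x⇒x≈0)
      q = p ℕ.^ e
      pow-cong : ∀ {x y} → x ≈ y → pow K x q ≈ pow K y q
      pow-cong {x} {y} h rewrite pow≡^ x q | pow≡^ y q = ^-congˡ q h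
      pow-+ : ∀ x y → pow K (x + y) q ≈ pow K x q + pow K y q
      pow-+ x y rewrite pow≡^ (x + y) q | pow≡^ x q | pow≡^ y q = ^p^-homo-+ e x y
      pow-* : ∀ x y → pow K (x * y) q ≈ pow K x q * pow K y q
      pow-* x y rewrite pow≡^ (x * y) q | pow≡^ x q | pow≡^ y q = ^-distrib-* x y q
      pow-0 : pow K 0# q ≈ 0#
      pow-0 = x+x≈x⇒x≈0 (pow K 0# q) (trans (sym (pow-+ 0# 0#)) (pow-cong (+-identityˡ 0#)))
      1^ : ∀ m → pow K 1# m ≈ 1#
      1^ zero    = refl
      1^ (suc m) = trans (*-identityˡ _) (1^ m)

-- Polynomial functions and their roots.

module PolynomialFunctions {c ℓ} (K : CommutativeRing c ℓ) where
  open CommutativeRing K hiding (zero) renaming (Carrier to A)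
  open IntegerSolver K

  -- A polynomial is recorded as a function together with a Horner scheme: `Low d` means degree less
  -- than d, and `Monic d` below means degree d with leading coefficient 1. Keeping only functions
  -- avoids coefficient arithmetic, as the goal is to count roots.
  data Low : ℕ → (A → A) → Set (c ⊔ ℓ) where
    low-zero : ∀ {f} → (∀ x → f x ≈ 0#) → Low zero f
    low-suc  : ∀ {d f g} k → Low d g → (∀ x → f x ≈ k + x * g x) → Low (suc d) f

  data Monic : ℕ → (A → A) → Set (c ⊔ ℓ) where
    monic-zero : ∀ {f} → (∀ x → f x ≈ 1#) → Monic zero f
    monic-suc  : ∀ {d f g} k → Monic d g → (∀ x → f x ≈ k + x * g x) → Monic (suc d) f

  low-cong : ∀ {d f g} → (∀ x → f x ≈ g x) → Low d g → Low d f
  low-cong f≈g (low-zero e)    = low-zero (λ x → trans (f≈g x) (e x))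
  low-cong f≈g (low-suc k l e) = low-suc k l (λ x → trans (f≈g x) (e x))

  monic-cong : ∀ {d f g} → (∀ x → f x ≈ g x) → Monic d g → Monic d f
  monic-cong f≈g (monic-zero e)    = monic-zero (λ x → trans (f≈g x) (e x))
  monic-cong f≈g (monic-suc k l e) = monic-suc k l (λ x → trans (f≈g x) (e x))

  low-shift : ∀ {d f} → Low d f → Low (suc d) (λ x → x * f x)
  low-shift l = low-suc 0# l (λ x → sym (+-identityˡ _))

  monic-shift : ∀ {d f} → Monic d f → Monic (suc d) (λ x → x * f x)
  monic-shift l = monic-suc 0# l (λ x → sym (+-identityˡ _))

  low-0 : ∀ d → Low d (λ _ → 0#)
  low-0 zero    = low-zero (λ _ → refl)
  low-0 (suc d) = low-suc 0# (low-0 d) (λ x → sym (trans (+-identityˡ _) (zeroʳ x)))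

  low-const : ∀ k → Low 1 (λ _ → k)
  low-const k = low-suc k (low-0 0) (λ x → sym (trans (+-congˡ (zeroʳ x)) (+-identityʳ k)))

  low-mono : ∀ {d e f} → d ℕ.≤ e → Low d f → Low e f
  low-mono {e = e} ℕ.z≤n (low-zero f≈0) = low-cong f≈0 (low-0 e)
  low-mono (ℕ.s≤s d≤e) (low-suc k l e) = low-suc k (low-mono d≤e l) e

  low-+ : ∀ {d f g} → Low d f → Low d g → Low d (λ x → f x + g x)
  low-+ (low-zero e) (low-zero e') = low-zero (λ x → trans (+-cong (e x) (e' x)) (+-identityˡ 0#))
  low-+ (low-suc k l e) (low-suc k' l' e') = low-suc (k + k') (low-+ l l') (λ x → trans (+-cong (e x) (e' x))
    (solve 5 (λ k k' x u v → k :+ x :* u :+ (k' :+ x :* v) := k :+ k' :+ x :* (u :+ v)) refl _ _ _ _ _))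

  low-scale : ∀ {d f} m → Low d f → Low d (λ x → m * f x)
  low-scale m (low-zero e)    = low-zero (λ x → trans (*-congˡ (e x)) (zeroʳ m))
  low-scale m (low-suc k l e) = low-suc (m * k) (low-scale m l) (λ x → trans (*-congˡ (e x))
    (solve 4 (λ m k x u → m :* (k :+ x :* u) := m :* k :+ x :* (m :* u)) refl _ _ _ _))

  monic⇒low : ∀ {d f} → Monic d f → Low (suc d) f
  monic⇒low (monic-zero e)    = low-cong e (low-const 1#)
  monic⇒low (monic-suc k m e) = low-suc k (monic⇒low m) e

  monic-+-low : ∀ {d f g} → Monic d f → Low d g → Monic d (λ x → f x + g x)
  monic-+-low (monic-zero e) (low-zero e') = monic-zero (λ x → trans (+-cong (e x) (e' x)) (+-identityʳ 1#))
  monic-+-low (monic-suc k l e) (low-suc k' l' e') = monic-suc (k + k') (monic-+-low l l') (λ x → trans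
      (+-cong (e x) (e' x))
    (solve 5 (λ k k' x u v → k :+ x :* u :+ (k' :+ x :* v) := k :+ k' :+ x :* (u :+ v)) refl _ _ _ _ _))

  low-*-monic : ∀ {d e f g} → Low d f → Monic e g → Low (d ℕ.+ e) (λ x → f x * g x)
  low-*-monic {e = e} (low-zero f≈0) _ = low-cong (λ x → trans (*-congʳ (f≈0 x)) (zeroˡ _)) (low-0 e)
  low-*-monic {suc d} {e} (low-suc k l h) m = low-cong
    (λ x → trans (*-congʳ (h x)) (solve 4 (λ k x u v → (k :+ x :* u) :* v := k :* v :+ x :*
        (u :* v)) refl _ _ _ _))
    (low-+ (low-mono (ℕ.s≤s (ℕₚ.m≤n+m e d)) (low-scale k (monic⇒low m))) (low-shift (low-*-monic l m)))

  monic-* : ∀ {d e f g} → Monic d f → Monic e g → Monic (d ℕ.+ e) (λ x → f x * g x)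
  monic-* (monic-zero f≈1) m = monic-cong (λ x → trans (*-congʳ (f≈1 x)) (*-identityˡ _)) m
  monic-* {suc d} {e} (monic-suc k l h) m = monic-cong
    (λ x → trans (*-congʳ (h x)) (solve 4 (λ k x u v → (k :+ x :* u) :* v := x :*
        (u :* v) :+ k :* v) refl _ _ _ _))
    (monic-+-low (monic-shift (monic-* l m)) (low-mono (ℕ.s≤s (ℕₚ.m≤n+m e d)) (low-scale k (monic⇒low m))))

  monic-pow : ∀ d → Monic d (λ x → pow K x d)
  monic-pow zero    = monic-zero (λ _ → refl)
  monic-pow (suc d) = monic-shift (monic-pow d)

  monic-+-linear : ∀ {d f} → 2 ℕ.≤ d → Monic d f → ∀ m k → Monic d (λ x → f x + (m * x + k))
  monic-+-linear 2≤d mf m k = monic-+-low mf (low-mono 2≤d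
    (low-suc k (low-const m) (λ x → trans (+-comm _ _) (+-congˡ (*-comm m x)))))

  monic-respects : ∀ {d f} → Monic d f → ∀ {x y} → x ≈ y → f x ≈ f y
  monic-respects (monic-zero e)    {x} {y} x≈y = trans (e x) (sym (e y))
  monic-respects (monic-suc k m e) {x} {y} x≈y =
    trans (e x) (trans (+-congˡ (*-cong x≈y (monic-respects m x≈y))) (sym (e y)))

  -- Synthetic division. If f = k + x h and h = h(r) + (x - r) g, then the quotient of f by x - r is
  -- h(r) + x g, again a Horner scheme.
  divide : ∀ {d f} → Monic (suc d) f → ∀ r → ∃ λ g → Monic d g × (∀ x → f x ≈ f r + (x - r) * g x)
  divide {f = f} (monic-suc {g = g} k (monic-zero g≈1) f≈) r = (λ _ → 1#) , monic-zero (λ _ → refl) , λ x →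
    trans (expand x) (trans (solve 3 (λ k x r → k :+ x :* one := k :+ r :* one :+ (x :- r) :* one) refl k x r)
                            (+-congʳ (sym (expand r))))
    where
    expand : ∀ x → f x ≈ k + x * 1#
    expand x = trans (f≈ x) (+-congˡ (*-congˡ (g≈1 x)))
  divide {f = f} (monic-suc {g = h} k m@(monic-suc _ _ _) f≈) r with divide m r
  ... | g , mg , h≈ = (λ x → h r + x * g x) , monic-suc (h r) mg (λ _ → refl) , λ x →
    trans (f≈ x) (trans (+-congˡ (*-congˡ (h≈ x)))
    (trans (solve 5 (λ k x r a b → k :+ x :* (a :+ (x :- r) :* b) := k :+ r :* a :+ (x :- r) :*
        (a :+ x :* b)) refl k x r (h r) (g x))
           (+-congʳ (sym (f≈ r)))))

module Roots {c ℓ} (K : CommutativeRing c ℓ) (isField : IsField K) {N} (size : HasSize K N) where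
  open CommutativeRing K hiding (zero) renaming (Carrier to A)
  open FiniteField K isField size
  open PolynomialFunctions K public
  open IntegerSolver K
  open import Algebra.Properties.Ring ring using () renaming (x∙y⁻¹≈ε⇒x≈y to x-y≈0⇒x≈y)

  -- The bound on the number of roots is phrased as a covering list of length d, the form that
  -- `avoid` consumes.
  root-cover : ∀ {d f} → Monic d f → ∃ λ (r : Fin d → A) → ∀ x → f x ≈ 0# → ∃ λ j → x ≈ r j
  root-cover {zero} (monic-zero e) = (λ ()) , λ x fx≈0 → contradiction (trans (sym (e x)) fx≈0) 1≉0
  root-cover {suc d} {f} m with Finₚ.any? (λ i → f (element i) ≟ 0#)
  -- Without any root every list covers; zeros fill it up to the required length.
  ... | no none = (λ _ → 0#) , λ x fx≈0 →
        contradiction (index x , trans (monic-respects m (element-index x)) fx≈0) none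
  ... | yes (i , fr≈0) with divide m (element i)
  ...   | g , mg , f≈ with root-cover mg
  ...     | r , covers = (λ { zero → element i ; (suc j) → r j }) , cover
    where
    cover : ∀ x → f x ≈ 0# → _
    cover x fx≈0 with no-zero-divisors (x - element i) (g x)
                        (trans (sym (trans (f≈ x) (trans (+-congʳ fr≈0) (+-identityˡ _)))) fx≈0)
    ... | inj₁ x-r≈0 = zero , x-y≈0⇒x≈y _ _ x-r≈0
    ... | inj₂ gx≈0 with covers x gx≈0
    ...   | j , e = suc j , e

  nonroot : ∀ {d f M} → Monic d f → (h : Fin M → A) → (∀ i j → h i ≈ h j → i ≡ j) → d ℕ.< M →
            ∃ λ i → ¬ f (h i) ≈ 0#
  nonroot m h inj d<M with root-cover m
  ... | r , covers with avoid _≟_ sym trans h inj r d<M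
  ...   | i , missed = i , λ e → missed _ (proj₂ (covers _ e))

  -- Greedy: the preimage of k values has at most k d elements.
  many-values : ∀ {d} {g : A → A} → (∀ s → Monic d (λ x → g x - s)) → 0 ℕ.< d → ∀ k → k ℕ.* d ℕ.≤ N →
                ∃ λ (h : Fin k → A) → ∀ (i j : Fin k) → g (h i) ≈ g (h j) → i ≡ j
  many-values m 0<d zero _ = (λ ()) , λ ()
  many-values {d} {g} m 0<d (suc k) d+kd≤N
    with many-values m 0<d k (ℕₚ.≤-trans (ℕₚ.m≤n+m (k ℕ.* d) d) d+kd≤N)
  ... | h , inj = extend (avoid _≟_ sym trans element element-injective (preimages ∘ Fin.remQuot d)
                                (ℕₚ.≤-trans (ℕₚ.+-monoˡ-≤ (k ℕ.* d) 0<d) d+kd≤N))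
    where
    preimages : Fin k × Fin d → A
    preimages (i , j) = proj₁ (root-cover (m (g (h i)))) j

    extend : (∃ λ i → ∀ j → ¬ element i ≈ preimages (Fin.remQuot d j)) →
             ∃ λ (h : Fin (suc k) → A) → ∀ (i j : Fin (suc k)) → g (h i) ≈ g (h j) → i ≡ j
    extend (i₀ , missed) = h' , distinct
      where
      h' : Fin (suc k) → A
      h' zero    = element i₀
      h' (suc i) = h i

      new : ∀ i → ¬ g (element i₀) ≈ g (h i)
      new i e with proj₂ (root-cover (m (g (h i)))) (element i₀) (trans (+-congʳ e) (-‿inverseʳ _))
      ... | j , e' = missed (Fin.combine i j)
        (trans e' (reflexive (≡.cong preimages (≡.sym (Finₚ.remQuot-combine i j)))))

      distinct : ∀ i j → g (h' i) ≈ g (h' j) → i ≡ j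
      distinct zero    zero    _ = ≡.refl
      distinct zero    (suc j) e = contradiction e (new j)
      distinct (suc i) zero    e = contradiction (sym e) (new i)
      distinct (suc i) (suc j) e = ≡.cong suc (inj i j e)

-- Spans over F_q, greedy bases and the reduction of scatteredness to ratios.

funToFin-cong : ∀ {m n} {f g : Fin m → Fin n} → (∀ i → f i ≡ g i) → Fin.funToFin f ≡ Fin.funToFin g
funToFin-cong {zero}  _ = ≡.refl
funToFin-cong {suc m} e = ≡.cong₂ Fin.combine (e zero) (funToFin-cong (e ∘ suc))

finToFun-injective : ∀ {m n} (i j : Fin (n ℕ.^ m)) →
  (∀ k → Fin.finToFun {n} {m} i k ≡ Fin.finToFun {n} {m} j k) → i ≡ j
finToFun-injective {m} {n} i j e = ≡.trans (≡.sym (Finₚ.funToFin-finToFin {m} {n} i))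
  (≡.trans (funToFin-cong e) (Finₚ.funToFin-finToFin {m} {n} j))

module SubfieldSpans {c ℓ} (K : CommutativeRing c ℓ) (isField : IsField K) {N} (size : HasSize K N)
  {q} (2≤q : 2 ℕ.≤ q)
  (σ-hom : IsRingHomomorphism (CommutativeRing.rawRing K) (CommutativeRing.rawRing K) (λ x → pow K x q))
  where
  open CommutativeRing K hiding (zero) renaming (Carrier to A)
  open FiniteField K isField size
  open Roots K isField size
  open IntegerSolver K
  open import Algebra.Properties.Ring ring using (-‿distribˡ-*)
  open import Relation.Binary.Reasoning.Setoid setoid
  private
    module σ = IsRingHomomorphism σ-hom

    V : Set c
    V = V3 K

    infix 4 _≈ᵥ_
    _≈ᵥ_ : V → V → Set ℓ
    _≈ᵥ_ = _≈v_ K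

  -- The elements of F_q are roots of x^q - x, so q values cover them. Hence q^k combinations cover
  -- a span of k vectors.
  Fq-cover : ∃ λ (r : Fin q → A) → ∀ x → InFq K q x → ∃ λ j → x ≈ r j
  Fq-cover with root-cover (monic-+-linear 2≤q (monic-pow q) (- 1#) 0#)
  ... | r , cover = r , λ x fix → cover x (trans (+-congʳ fix)
        (trans (+-congˡ (+-congʳ (sym (-‿distribˡ-* 1# x)))) (solve 1 (λ x → x :+ (:-
            (one :* x) :+ nil) := nil) refl x)))

  lincomb-cong : ∀ k {cs ds : Fin k → A} bs → (∀ i → cs i ≈ ds i) → _≈ᵥ_ (lincomb K k cs bs) (lincomb K k ds bs)
  lincomb-cong zero    bs e i = refl
  lincomb-cong (suc k) bs e i = +-cong (*-congʳ (e zero)) (lincomb-cong k (bs ∘ suc) (e ∘ suc) i)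

  lincomb-scale : ∀ k m cs bs → _≈ᵥ_ (lincomb K k (λ i → m * cs i) bs) (_·v_ K m (lincomb K k cs bs))
  lincomb-scale zero    m cs bs i = sym (zeroʳ m)
  lincomb-scale (suc k) m cs bs i = trans (+-congˡ (lincomb-scale k m (cs ∘ suc) (bs ∘ suc) i))
    (solve 4 (λ m c b r → m :* c :* b :+ m :* r := m :* (c :* b :+ r)) refl _ _ _ _)

  span-cover : ∀ k (bs : Fin k → V) →
               ∃ λ (s : Fin (q ℕ.^ k) → V) → ∀ w → InSpan K q k bs w → ∃ λ j → w ≈ᵥ s j
  span-cover k bs = (λ j → lincomb K k (proj₁ Fq-cover ∘ Fin.finToFun j) bs) , λ w → λ { (cs , fix , w≈) →
    let code = λ i → proj₁ (proj₂ Fq-cover (cs i) (fix i))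
    in Fin.funToFin code , λ i → trans (w≈ i) (lincomb-cong k bs (λ j →
         trans (proj₂ (proj₂ Fq-cover (cs j) (fix j)))
               (reflexive (≡.cong (proj₁ Fq-cover) (≡.sym (Finₚ.finToFun-funToFin code j))))) i) }

  independent-∷ : ∀ k (bs : Fin (suc k) → V) → FqIndependent K q k (bs ∘ suc) →
                  ¬ InSpan K q k (bs ∘ suc) (bs zero) → FqIndependent K q (suc k) bs
  independent-∷ k bs ind outside cs fix lc≈0 with cs zero ≟ 0#
  ... | yes c₀≈0 = λ { zero → c₀≈0 ; (suc i) → ind (cs ∘ suc) (fix ∘ suc) rest≈0 i }
    where
    rest≈0 : lincomb K k (cs ∘ suc) (bs ∘ suc) ≈ᵥ 0v K
    rest≈0 i = trans (sym (trans (+-congʳ (trans (*-congʳ c₀≈0) (zeroˡ _))) (+-identityˡ _))) (lc≈0 i)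
  ... | no c₀≉0 with proj₂ isField (cs zero) c₀≉0
  ...   | y , c₀y≈1 = contradiction ((λ i → - y * cs (suc i)) , fix' , expressed) outside
    where
    fix' : ∀ i → InFq K q (- y * cs (suc i))
    fix' i = trans (σ.*-homo _ _) (*-cong (trans (σ.-‿homo y) (-‿cong (fixed-inverse σ-hom c₀y≈1
        (fix zero)))) (fix (suc i)))
    expressed : bs zero ≈ᵥ lincomb K k (λ i → - y * cs (suc i)) (bs ∘ suc)
    expressed i = begin
      b                     ≈⟨ solve 4 (λ b c y r → b := (one :- c :* y) :* b :+ y :*
          (c :* b :+ r) :+ :- y :* r) refl b (cs zero) y r ⟩
      (1# - cs zero * y) * b + y * (cs zero * b + r) + - y * r
                            ≈⟨ +-congʳ (+-cong (*-congʳ (trans (+-congˡ (-‿cong c₀y≈1))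
                                (-‿inverseʳ 1#))) (*-congˡ (lc≈0 i))) ⟩
      0# * b + y * 0# + - y * r
                            ≈⟨ solve 3 (λ b y r → nil :* b :+ y :* nil :+ r := r) refl b y (- y * r) ⟩
      - y * r               ≈⟨ lincomb-scale k (- y) (cs ∘ suc) (bs ∘ suc) i ⟨
      lincomb K k (λ i → - y * cs (suc i)) (bs ∘ suc) i ∎
      where
      b = bs zero i
      r = lincomb K k (cs ∘ suc) (bs ∘ suc) i

  independent-family : ∀ {M} (h : Fin M → V) → (∀ i j → h i ≈ᵥ h j → i ≡ j) → ∀ k → q ℕ.^ k ℕ.≤ M →
    ∃ λ (bs : Fin k → V) → (∀ i → ∃ λ j → bs i ≡ h j) × FqIndependent K q k bs
  independent-family h inj zero    _ = (λ ()) , (λ ()) , λ _ _ _ ()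
  independent-family {M} h inj (suc k) q^[k+1]≤M
    with independent-family h inj k (ℕₚ.≤-trans (ℕₚ.<⇒≤ q^k<q^[k+1]) q^[k+1]≤M)
    where
    q^k<q^[k+1] = ℕₚ.^-monoʳ-< q 2≤q (ℕₚ.n<1+n k)
  ... | bs , from , ind with span-cover k bs
  ...   | s , covers with avoid (λ u w → Finₚ.all? (λ i → u i ≟ w i)) (λ e i → sym (e i)) (λ e e' i →
      trans (e i) (e' i))
                            h inj s (ℕₚ.≤-trans (ℕₚ.^-monoʳ-< q 2≤q (ℕₚ.n<1+n k)) q^[k+1]≤M)
  ...     | j , missed = bs' , from' , independent-∷ k bs' ind (λ w∈ → missed _ (proj₂ (covers _ w∈)))
    where
    bs' : Fin (suc k) → V
    bs' zero    = h j
    bs' (suc i) = bs i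
    from' : ∀ i → ∃ λ j → bs' i ≡ h j
    from' zero    = j , ≡.refl
    from' (suc i) = from i

  record IsFqSubspace (U : V → Set (c ⊔ ℓ)) : Set (c ⊔ ℓ) where
    field
      resp     : ∀ {v w} → w ≈ᵥ v → U v → U w
      0-closed : U (0v K)
      +-closed : ∀ {v w} → U v → U w → U (_+v_ K v w)
      ·-closed : ∀ {m v} → InFq K q m → U v → U (_·v_ K m v)

    lincomb-closed : ∀ k {cs bs} → (∀ i → InFq K q (cs i)) → (∀ i → U (bs i)) → U (lincomb K k cs bs)
    lincomb-closed zero    fix bs∈ = 0-closed
    lincomb-closed (suc k) fix bs∈ =
      +-closed (·-closed (fix zero) (bs∈ zero)) (lincomb-closed k (fix ∘ suc) (bs∈ ∘ suc))

    span⊆ : ∀ k {bs w} → (∀ i → U (bs i)) → InSpan K q k bs w → U w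
    span⊆ k bs∈ (cs , fix , w≈) = resp w≈ (lincomb-closed k fix bs∈)

  module _ {U : V → Set (c ⊔ ℓ)} (subspace : IsFqSubspace U)
    (ratio : ∀ {v w} m → U v → U w → ¬ v ≈ᵥ 0v K → w ≈ᵥ _·v_ K m v → InFq K q m) where
    open IsFqSubspace subspace

    -- When proportional vectors of U have ratio in F_q, the multiples of v inside U are its
    -- F_q-multiples, and v alone is a basis of the intersection.
    scattered : ∀ k {bs} → (∀ i → U (bs i)) → Scattered K q k bs
    scattered k {bs} bs∈ v v∈ v≉0 =
      (λ _ → v) , (λ _ → v∈ , 1# , λ i → sym (*-identityˡ (v i))) , independent , spanning
      where
      independent : FqIndependent K q 1 (λ _ → v)
      independent cs fix lc≈0 zero with cs zero ≟ 0#
      ... | yes c₀≈0 = c₀≈0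
      ... | no  c₀≉0 = contradiction (λ i → cancel-nonzero c₀≉0 (begin
        v i * cs zero         ≈⟨ *-comm _ _ ⟩
        cs zero * v i         ≈⟨ +-identityʳ _ ⟨
        cs zero * v i + 0#    ≈⟨ lc≈0 i ⟩
        0#                    ∎)) v≉0
      spanning : ∀ w → InSpan K q k bs w × Σ A (λ m → w ≈ᵥ _·v_ K m v) → InSpan K q 1 (λ _ → v) w
      spanning w (w∈ , m , w≈mv) =
        (λ _ → m) , (λ _ → ratio m (span⊆ k bs∈ v∈) (span⊆ k bs∈ w∈) v≉0 w≈mv) ,
        λ i → trans (w≈mv i) (sym (+-identityʳ _))

-- From two proportional points to an eigenvector equation.

-- The points ω x + a τ(x) and ω y + a τ(y) with ratio α + β ω, where ω² = A ω + B.
module ProportionalPoints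
  {c ℓ c' ℓ'} (K : CommutativeRing c ℓ) (S : CommutativeRing c' ℓ')
  {ι : CommutativeRing.Carrier K → CommutativeRing.Carrier S}
  (ι-hom : IsRingHomomorphism (CommutativeRing.rawRing K) (CommutativeRing.rawRing S) ι)
  {σ : CommutativeRing.Carrier K → CommutativeRing.Carrier K}
  (σ-hom : IsRingHomomorphism (CommutativeRing.rawRing K) (CommutativeRing.rawRing K) σ)
  {τ : CommutativeRing.Carrier S → CommutativeRing.Carrier S}
  (τ-hom : IsRingHomomorphism (CommutativeRing.rawRing S) (CommutativeRing.rawRing S) τ)
  (τι≈ισ : ∀ k → CommutativeRing._≈_ S (τ (ι k)) (ι (σ k)))
  (n : ℕ)
  where
  open CommutativeRing S hiding (zero)
  private
    module K = CommutativeRing K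
    module ι = IsRingHomomorphism ι-hom
    module σ = IsRingHomomorphism σ-hom
    module τ = IsRingHomomorphism τ-hom
    module σⁿ = IsRingHomomorphism (iter-isRingHomomorphism K σ-hom n)
    module τⁿ = IsRingHomomorphism (iter-isRingHomomorphism S τ-hom n)
  open IntegerSolver S
  open import Algebra.Properties.Ring ring using () renaming (x∙y⁻¹≈ε⇒x≈y to x-y≈0⇒x≈y)
  open import Relation.Binary.Reasoning.Setoid setoid
  open Matrices K σ-hom
  open MatrixAction K S ι-hom σ-hom τ-hom τι≈ισ
  open Norm S τ-hom

  Fixedₖ : K.Carrier → Set ℓ
  Fixedₖ k = iter σ n k K.≈ k

  Fixed : Carrier → Set ℓ'
  Fixed x = iter τ n x ≈ x

  fixed-+ : ∀ {x y} → Fixed x → Fixed y → Fixed (x + y)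
  fixed-+ fx fy = trans (τⁿ.+-homo _ _) (+-cong fx fy)

  fixed-* : ∀ {x y} → Fixed x → Fixed y → Fixed (x * y)
  fixed-* fx fy = trans (τⁿ.*-homo _ _) (*-cong fx fy)

  fixed-neg : ∀ {x} → Fixed x → Fixed (- x)
  fixed-neg fx = trans (τⁿ.-‿homo _) (-‿cong fx)

  fixed-τ : ∀ {x} → Fixed x → Fixed (τ x)
  fixed-τ {x} fx = trans (reflexive (iter-suc τ n x)) (τ.⟦⟧-cong fx)

  iter-ι : ∀ k x → iter τ k (ι x) ≈ ι (iter σ k x)
  iter-ι zero    x = refl
  iter-ι (suc k) x = trans (τ.⟦⟧-cong (iter-ι k x)) (τι≈ισ _)

  fixed-ι : ∀ {k} → Fixedₖ k → Fixed (ι k)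
  fixed-ι {k} fk = trans (iter-ι n k) (ι.⟦⟧-cong fk)

  module Pair {ω A B α β : K.Carrier} {a x y : Carrier}
    (independent : ∀ {p r} → Fixed p → Fixed r → ι ω * p + r ≈ 0# → p ≈ 0# × r ≈ 0#)
    (ω²≈ : ω K.* ω K.≈ A K.* ω K.+ B)
    (A-fixed : Fixedₖ A) (B-fixed : Fixedₖ B) (α-fixed : Fixedₖ α) (β-fixed : Fixedₖ β)
    (a-fixed : Fixed a) (x-fixed : Fixed x) (y-fixed : Fixed y)
    (proportional : ι (α K.+ β K.* ω) * (ι ω * x + a * τ x) ≈ ι ω * y + a * τ y)
    where
    private
      X = a * τ x
      Y = a * τ y

      -- Expanding (α + β ω)(ω x + X) and replacing ω² by A ω + B gives the ω-coordinate α x + β A x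
      -- + β X and the remaining coordinate α X + β B x. All these are fixed by τⁿ, so independence
      -- of ω and 1 lets them be compared with y and Y.
      coordinates : y - (ι α * x + ι β * ι A * x + ι β * X) ≈ 0# × Y - (ι α * X + ι β * ι B * x) ≈ 0#
      coordinates = independent
        (fixed-+ y-fixed (fixed-neg (fixed-+ (fixed-+ (fixed-* α' x-fixed) (fixed-*
            (fixed-* β' A') x-fixed)) (fixed-* β' X'))))
        (fixed-+ (fixed-* a-fixed (fixed-τ y-fixed)) (fixed-neg (fixed-+ (fixed-* α' X') (fixed-*
            (fixed-* β' B') x-fixed))))
        (begin
          w * (y - (ι α * x + ι β * ι A * x + ι β * X)) + (Y - (ι α * X + ι β * ι B * x))
            ≈⟨ solve 9 (λ w A B α β x y X Y →
                 w :* (y :- (α :* x :+ β :* A :* x :+ β :* X)) :+ (Y :- (α :* X :+ β :* B :* x)) :=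
                 (w :* y :+ Y) :- (α :+ β :* w) :* (w :* x :+ X) :+ β :* x :* (w :* w :- (A :* w :+ B)))
               refl w (ι A) (ι B) (ι α) (ι β) x y X Y ⟩
          (w * y + Y) - (ι α + ι β * w) * (w * x + X) + ι β * x * (w * w - (ι A * w + ι B))
            ≈⟨ +-cong (+-congˡ (-‿cong (trans (*-congʳ (sym (ι-+* α β ω))) proportional)))
                      (*-congˡ (+-congʳ (trans (sym (ι.*-homo ω ω)) (trans (ι.⟦⟧-cong ω²≈) ι-A)))) ⟩
          (w * y + Y) - (w * y + Y) + ι β * x * ((ι A * w + ι B) - (ι A * w + ι B))
            ≈⟨ solve 3 (λ u v b → u :- u :+ b :* (v :- v) := nil) refl _ _ _ ⟩
          0# ∎)
        where
        w = ι ω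
        α' = fixed-ι α-fixed
        β' = fixed-ι β-fixed
        A' = fixed-ι A-fixed
        B' = fixed-ι B-fixed
        X' = fixed-* a-fixed (fixed-τ x-fixed)
        ι-+* : ∀ α β ω → ι (α K.+ β K.* ω) ≈ ι α + ι β * ι ω
        ι-+* α β ω = trans (ι.+-homo _ _) (+-congˡ (ι.*-homo _ _))
        ι-A : ι (A K.* ω K.+ B) ≈ ι A * w + ι B
        ι-A = trans (ι.+-homo _ _) (+-congʳ (ι.*-homo _ _))

    ω-coordinate : y ≈ ι α * x + ι β * ι A * x + ι β * X
    ω-coordinate = x-y≈0⇒x≈y _ _ (proj₁ coordinates)

    1-coordinate : Y ≈ ι α * X + ι β * ι B * x
    1-coordinate = x-y≈0⇒x≈y _ _ (proj₂ coordinates)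

    -- The matrix comes from eliminating y. Applying τ to the ω-coordinate and multiplying by a
    -- expresses Y = a τ(y) through X = a τ(x) and a τ(X); equating this with α X + β B x gives the
    -- first row. The second row is the definition of X multiplied by σ(β).
    M : Mat
    M = mat (α K.- (σ α K.+ σ (β K.* A))) (β K.* B) (σ β) K.0#

    multiplier : Carrier
    multiplier = ι (σ β) * a

    M-eigen : Eigen M multiplier X x (τ X) (τ x)
    M-eigen = eigen upper lower
      where
      τy : τ y ≈ ι (σ α) * τ x + ι (σ (β K.* A)) * τ x + ι (σ β) * τ X
      τy = begin
        τ y
          ≈⟨ τ.⟦⟧-cong ω-coordinate ⟩
        τ (ι α * x + ι β * ι A * x + ι β * X)
          ≈⟨ trans (τ.+-homo _ _) (+-cong (τ.+-homo _ _) (τ.*-homo _ _)) ⟩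
        τ (ι α * x) + τ (ι β * ι A * x) + τ (ι β) * τ X
          ≈⟨ +-cong (+-cong (trans (τ.*-homo _ _) (*-congʳ (τι≈ισ α)))
                            (trans (τ.*-homo _ _) (*-congʳ (trans (τ.⟦⟧-cong (sym (ι.*-homo β A))) (τι≈ισ _)))))
                    (*-congʳ (τι≈ισ β)) ⟩
        ι (σ α) * τ x + ι (σ (β K.* A)) * τ x + ι (σ β) * τ X ∎

      difference : ∀ a b c → ι (a K.- (b K.+ c)) ≈ ι a - (ι b + ι c)
      difference a b c = trans (ι.+-homo _ _) (+-congˡ (trans (ι.-‿homo _) (-‿cong (ι.+-homo _ _))))

      upper : ι (α K.- (σ α K.+ σ (β K.* A))) * X + ι (β K.* B) * x ≈ multiplier * τ X
      upper = begin
        ι (α K.- (σ α K.+ σ (β K.* A))) * X + ι (β K.* B) * x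
          ≈⟨ +-cong (*-congʳ (difference _ _ _)) (*-congʳ (ι.*-homo β B)) ⟩
        (ι α - (ι (σ α) + ι (σ (β K.* A)))) * X + ι β * ι B * x
          ≈⟨ solve 6 (λ α s t X b x → (α :- (s :+ t)) :* X :+ b :* x := α :* X :+ b :* x :- (s :+ t) :* X)
               refl _ _ _ _ _ _ ⟩
        ι α * X + ι β * ι B * x - (ι (σ α) + ι (σ (β K.* A))) * X
          ≈⟨ +-congʳ (trans (sym 1-coordinate) (*-congˡ τy)) ⟩
        a * (ι (σ α) * τ x + ι (σ (β K.* A)) * τ x + ι (σ β) * τ X) - (ι (σ α) + ι (σ (β K.* A))) * X
          ≈⟨ solve 6 (λ a s t b x X → a :* (s :* x :+ t :* x :+ b :* X) :- (s :+ t) :* (a :* x) := b :* a :* X)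
               refl _ _ _ _ _ _ ⟩
        multiplier * τ X ∎

      lower : ι (σ β) * X + ι K.0# * x ≈ multiplier * τ x
      lower = trans (+-congˡ (*-congʳ ι.0#-homo))
        (solve 4 (λ b a t x → b :* (a :* t) :+ nil :* x := b :* a :* t) refl _ _ _ _)

    private
      σ-fixed : ∀ {k} → Fixedₖ k → Fixedₖ (σ k)
      σ-fixed {k} fk = K.trans (K.reflexive (iter-suc σ n k)) (σ.⟦⟧-cong fk)

    M-fixed : mapₘ (iter σ n) M ≈ₘ M
    M-fixed = mat≈
      (K.trans (σⁿ.+-homo _ _) (K.+-cong α-fixed (K.trans (σⁿ.-‿homo _) (K.-‿cong
        (K.trans (σⁿ.+-homo _ _) (K.+-cong (σ-fixed α-fixed) (σ-fixed βA-fixed)))))))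
      (K.trans (σⁿ.*-homo _ _) (K.*-cong β-fixed B-fixed))
      (σ-fixed β-fixed)
      σⁿ.0#-homo
      where
      βA-fixed : Fixedₖ (β K.* A)
      βA-fixed = K.trans (σⁿ.*-homo _ _) (K.*-cong β-fixed A-fixed)

    eigenvalue : Carrier
    eigenvalue = norm n multiplier

    eigenvalue-fixed : τ eigenvalue ≈ eigenvalue
    eigenvalue-fixed = norm-fixed n (fixed-* (fixed-ι (σ-fixed β-fixed)) a-fixed)

    characteristic-equation :
      (eigenvalue * eigenvalue - ι (trace (power n M)) * eigenvalue + ι (det (power n M))) * x ≈ 0#
    characteristic-equation = cayley-hamilton (eigen
      (trans (Eigen.upper e) (*-congˡ (fixed-* a-fixed (fixed-τ x-fixed))))
      (trans (Eigen.lower e) (*-congˡ x-fixed)))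
      where e = eigen-power M-eigen n

-- The subfields F_q and F, and the choice of ω and γ.

module _ {c ℓ} (K : CommutativeRing c ℓ) where
  open CommutativeRing K

  -- Says that t³ - t - γ has no root in the field fixed by σ; for a cubic over that field this is
  -- irreducibility.
  NotCubicValue : (Carrier → Carrier) → Carrier → Set (c ⊔ ℓ)
  NotCubicValue σ γ = ∀ r → σ r ≈ r → ¬ r * r * r - r ≈ γ

module FrobeniusFixedField {c ℓ} (K : CommutativeRing c ℓ) (isField : IsField K)
  {q n} (size : HasSize K (q ℕ.^ (2 ℕ.* n))) (2≤q : 2 ℕ.≤ q) (1≤n : 1 ℕ.≤ n)
  (σ-hom : IsRingHomomorphism (CommutativeRing.rawRing K) (CommutativeRing.rawRing K) (λ x → pow K x q))
  where
  open CommutativeRing K hiding (zero) renaming (Carrier to A)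
  open FiniteField K isField size
  open Roots K isField size
  open IntegerSolver K
  open import Algebra.Properties.Ring ring using (-‿distribˡ-*)
  open import Algebra.Properties.CommutativeSemiring.Exp commutativeSemiring using (_^_; ^-assocʳ)
  open import Relation.Binary.Reasoning.Setoid setoid
  private module σ = IsRingHomomorphism σ-hom

  σ : A → A
  σ x = pow K x q

  σⁿ : A → A
  σⁿ = iter σ n

  σⁿ-hom : IsRingHomomorphism rawRing rawRing σⁿ
  σⁿ-hom = iter-isRingHomomorphism K σ-hom n

  iter-σ : ∀ k x → iter σ k x ≈ pow K x (q ℕ.^ k)
  iter-σ zero    x = sym (*-identityʳ x)
  iter-σ (suc k) x = begin
    σ (iter σ k x)                 ≈⟨ σ.⟦⟧-cong (iter-σ k x) ⟩
    pow K (pow K x (q ℕ.^ k)) q    ≡⟨ pow≡^ (pow K x (q ℕ.^ k)) q ⟩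
    pow K x (q ℕ.^ k) ^ q          ≡⟨ ≡.cong (_^ q) (pow≡^ x (q ℕ.^ k)) ⟩
    (x ^ (q ℕ.^ k)) ^ q            ≈⟨ ^-assocʳ x (q ℕ.^ k) q ⟩
    x ^ (q ℕ.^ k ℕ.* q)            ≡⟨ ≡.cong (x ^_) (ℕₚ.*-comm (q ℕ.^ k) q) ⟩
    x ^ (q ℕ.^ suc k)              ≡⟨ pow≡^ x (q ℕ.^ suc k) ⟨
    pow K x (q ℕ.^ suc k)          ∎

  σⁿσⁿ : ∀ x → σⁿ (σⁿ x) ≈ x
  σⁿσⁿ x = begin
    σⁿ (σⁿ x)                      ≡⟨ iter-+ σ n n x ⟨
    iter σ (n ℕ.+ n) x             ≡⟨ ≡.cong (λ k → iter σ (n ℕ.+ k) x) (≡.sym (ℕₚ.+-identityʳ n)) ⟩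
    iter σ (2 ℕ.* n) x             ≈⟨ iter-σ (2 ℕ.* n) x ⟩
    pow K x (q ℕ.^ (2 ℕ.* n))      ≈⟨ x^N≈x x ⟩
    x                              ∎

  iter-fixed : ∀ k {x} → σ x ≈ x → iter σ k x ≈ x
  iter-fixed zero    fix = refl
  iter-fixed (suc k) fix = trans (σ.⟦⟧-cong (iter-fixed k fix)) fix

  private
    2≤q^n : 2 ℕ.≤ q ℕ.^ n
    2≤q^n = ℕₚ.≤-trans 2≤q (≡.subst (ℕ._≤ q ℕ.^ n) (ℕₚ.*-identityʳ q)
              (ℕₚ.^-monoʳ-≤ q {{ℕ.>-nonZero (ℕₚ.<⇒≤ 2≤q)}} 1≤n))

    q^n<q^2n : q ℕ.^ n ℕ.< q ℕ.^ (2 ℕ.* n)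
    q^n<q^2n = ℕₚ.^-monoʳ-< q 2≤q (≡.subst (n ℕ.<_) (≡.cong (n ℕ.+_) (≡.sym (ℕₚ.+-identityʳ n)))
                 (ℕₚ.m<m+n n 1≤n))

  -- The elements fixed by σⁿ are roots of a monic polynomial of degree q^n, fewer than the q^(2n)
  -- elements of K.
  moved-element : ∃ λ ω → ¬ σⁿ ω ≈ ω
  moved-element with nonroot (monic-+-linear 2≤q^n (monic-pow (q ℕ.^ n))
      (- 1#) 0#) element element-injective q^n<q^2n
  ... | i , nonzero = element i , λ fix → nonzero (begin
    pow K (element i) (q ℕ.^ n) + (- 1# * element i + 0#)
      ≈⟨ +-cong (trans (sym (iter-σ n (element i))) fix) (+-congʳ (sym (-‿distribˡ-* _ _))) ⟩
    element i + (- (1# * element i) + 0#)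
      ≈⟨ solve 1 (λ x → x :+ (:- (one :* x) :+ nil) := nil) refl (element i) ⟩
    0# ∎)

  -- The trace x ↦ x + σⁿ(x) takes at least q^2n / q^n values.
  fixed-elements : ∃ λ (h : Fin (q ℕ.^ n) → A) → (∀ i j → h i ≈ h j → i ≡ j) × (∀ i → σⁿ (h i) ≈ h i)
  fixed-elements with many-values {g = λ x → pow K x (q ℕ.^ n) + (1# * x + 0#)}
      (λ s → monic-cong (λ x → +-assoc _ _ _) (monic-+-low (monic-pow (q ℕ.^ n))
        (low-mono 2≤q^n (low-suc (- s) (low-const 1#) (λ x →
          solve 2 (λ x s → one :* x :+ nil :- s := :- s :+ x :* one) refl x s)))))
      (ℕₚ.<⇒≤ 2≤q^n) (q ℕ.^ n)
      (ℕₚ.≤-reflexive (≡.trans (≡.sym (ℕₚ.^-distribˡ-+-* q n n)) (≡.cong (λ k → q ℕ.^ (n ℕ.+ k)) (≡.sym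
          (ℕₚ.+-identityʳ n)))))
  -- As σⁿ is an involution, it swaps the two summands of x + σⁿ(x), so the trace values lie in F.
  ... | h , inj = (λ i → h i + σⁿ (h i)) , (λ i j e → inj i j (trans (value i) (trans e (sym (value j))))) ,
    λ i → trans (IsRingHomomorphism.+-homo σⁿ-hom _ _) (trans (+-congˡ (σⁿσⁿ _)) (+-comm _ _))
    where
    value : ∀ i → pow K (h i) (q ℕ.^ n) + (1# * h i + 0#) ≈ h i + σⁿ (h i)
    value i = trans (+-congʳ (sym (iter-σ n (h i)))) (solve 2 (λ x y → y :+ (one :* x :+ nil)
        := x :+ y) refl _ _)

  -- On F_q the map r ↦ r³ - r takes the value 0 at both 0 and 1, hence is not onto.
  cubic-nonvalue : ∃ λ γ → σ γ ≈ γ × NotCubicValue K σ γ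
  cubic-nonvalue = missed-value
    (avoid _≟_ sym trans element element-injective s (ℕₚ.≤-reflexive (proj₁ (proj₂ nonzeros))))
    where
    open NonzeroEnumeration (proj₂ (proj₂ nonzeros))

    -- The map r ↦ r³ - r on F_q is extended by the identity to all of K, so a missed value must lie
    -- in F_q: outside F_q every element hits itself. It is tabulated on nonzero elements only, N -
    -- 1 of them, because 0 has the same value as 1; hence some element of K is missed.
    f : ∀ x → Dec (σ x ≈ x) → A
    f x (yes _) = x * x * x - x
    f x (no _)  = x

    s : Fin (proj₁ nonzeros) → A
    s j = f (unit j) (σ (unit j) ≟ unit j)

    s-fixed : ∀ j {r} → unit j ≈ r → σ r ≈ r → s j ≈ r * r * r - r
    s-fixed j u≈r fix with σ (unit j) ≟ unit j
    ... | yes _ = +-cong (*-cong (*-cong u≈r u≈r) u≈r) (-‿cong u≈r)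
    ... | no ¬fix = contradiction (trans (σ.⟦⟧-cong u≈r) (trans fix (sym u≈r))) ¬fix

    s-moved : ∀ j {r} → unit j ≈ r → ¬ σ r ≈ r → s j ≈ r
    s-moved j u≈r ¬fix with σ (unit j) ≟ unit j
    ... | yes fix = contradiction (trans (σ.⟦⟧-cong (sym u≈r)) (trans fix u≈r)) ¬fix
    ... | no _ = u≈r

    missed-value : (∃ λ i → ∀ j → ¬ element i ≈ s j) →
                   ∃ λ γ → σ γ ≈ γ × NotCubicValue K σ γ
    missed-value (i , missed) = γ , γ-fixed , nonvalue
      where
      γ = element i

      γ-fixed : σ γ ≈ γ
      γ-fixed with σ γ ≟ γ
      ... | yes fix = fix
      ... | no ¬fix with unit-index γ (λ γ≈0 → ¬fix (trans (σ.⟦⟧-cong γ≈0) (trans σ.0#-homo (sym γ≈0))))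
      ...   | j , u≈γ = contradiction (sym (s-moved j u≈γ ¬fix)) (missed j)

      nonzero-nonvalue : ∀ r → ¬ r ≈ 0# → σ r ≈ r → ¬ r * r * r - r ≈ γ
      nonzero-nonvalue r r≉0 fix e with unit-index r r≉0
      ... | j , u≈r = missed j (trans (sym e) (sym (s-fixed j u≈r fix)))

      nonvalue : NotCubicValue K σ γ
      nonvalue r fix e with r ≟ 0#
      ... | no r≉0  = nonzero-nonvalue r r≉0 fix e
      ... | yes r≈0 = nonzero-nonvalue 1# 1≉0 σ.1#-homo (begin
        1# * 1# * 1# - 1#  ≈⟨ solve 0 (one :* one :* one :- one := nil) refl ⟩
        0#                 ≈⟨ solve 0 (nil := nil :* nil :* nil :- nil) refl ⟩
        0# * 0# * 0# - 0#  ≈⟨ +-cong (*-cong (*-cong r≈0 r≈0) r≈0) (-‿cong r≈0) ⟨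
        r * r * r - r      ≈⟨ e ⟩
        γ                  ∎)

-- The cubic field E inside R, as the elements fixed by `τ`.

module FqCubicField {c ℓ} (K : CommutativeRing c ℓ) (isField : IsField K) {N} (size : HasSize K N)
  {σ : CommutativeRing.Carrier K → CommutativeRing.Carrier K}
  (σ-hom : IsRingHomomorphism (CommutativeRing.rawRing K) (CommutativeRing.rawRing K) σ)
  {γ : CommutativeRing.Carrier K} (γ-fixed : CommutativeRing._≈_ K (σ γ) γ) (γ-nonvalue : NotCubicValue K σ γ)
  where
  open CommutativeRing K hiding (zero) renaming (Carrier to A)
  open FiniteField K isField size
  open IntegerSolver K
  open import Algebra.Properties.Ring ring using () renaming (x∙y⁻¹≈ε⇒x≈y to x-y≈0⇒x≈y)
  open import Relation.Binary.Reasoning.Setoid setoid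
  open CubicExtension K γ
  private
    module σ = IsRingHomomorphism σ-hom
    module R = CommutativeRing cubicRing

  τ : Cubic → Cubic
  τ = mapC σ-hom γ-fixed

  τ-hom : IsRingHomomorphism R.rawRing R.rawRing τ
  τ-hom = mapC-isRingHomomorphism σ-hom γ-fixed

  σ-fixed-+ : ∀ {x y} → σ x ≈ x → σ y ≈ y → σ (x + y) ≈ x + y
  σ-fixed-+ fx fy = trans (σ.+-homo _ _) (+-cong fx fy)

  σ-fixed-* : ∀ {x y} → σ x ≈ x → σ y ≈ y → σ (x * y) ≈ x * y
  σ-fixed-* fx fy = trans (σ.*-homo _ _) (*-cong fx fy)

  σ-fixed-neg : ∀ {x} → σ x ≈ x → σ (- x) ≈ - x
  σ-fixed-neg fx = trans (σ.-‿homo _) (-‿cong fx)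

  -- The equation is the homogenised form of r³ - r = γ: if s is nonzero, then r/s is a forbidden
  -- solution in the fixed field, and if s = 0, then r³ = 0.
  cubic-form-anisotropic : ∀ {r s} → σ r ≈ r → σ s ≈ s → γ * (s * s * s) ≈ r * r * r - r * s * s →
      s ≈ 0# × r ≈ 0#
  cubic-form-anisotropic {r} {s} fr fs e with s ≟ 0#
  ... | yes s≈0 = s≈0 , r≈0
    where
    r³≈0 : r * r * r ≈ 0#
    r³≈0 = begin
      r * r * r                          ≈⟨ solve 2 (λ r s → r :* r :* r
          := r :* r :* r :- r :* s :* s :+ r :* s :* s) refl r s ⟩
      r * r * r - r * s * s + r * s * s  ≈⟨ +-congʳ e ⟨
      γ * (s * s * s) + r * s * s        ≈⟨ solve 3 (λ g r s → g :* (s :* s :* s) :+ r :* s :* s :=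
          (g :* (s :* s) :+ r :* s) :* s) refl γ r s ⟩
      (γ * (s * s) + r * s) * s          ≈⟨ *-congˡ s≈0 ⟩
      (γ * (s * s) + r * s) * 0#         ≈⟨ zeroʳ _ ⟩
      0#                                 ∎
    r≈0 : r ≈ 0#
    r≈0 with r ≟ 0#
    ... | yes e   = e
    ... | no  r≉0 = contradiction r³≈0 (*-nonzero (*-nonzero r≉0 r≉0) r≉0)
  ... | no s≉0 with proj₂ isField s s≉0
  ...   | i , si≈1 = contradiction (begin
          r * i * (r * i) * (r * i) - r * i
            ≈⟨ +-congˡ (-‿cong (trans (sym (*-identityʳ _)) (*-congˡ (sym (trans (*-cong si≈1 si≈1)
                (*-identityʳ 1#)))))) ⟩
          r * i * (r * i) * (r * i) - r * i * (s * i * (s * i))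
            ≈⟨ solve 3 (λ r s i → r :* i :* (r :* i) :* (r :* i) :- r :* i :* (s :* i :* (s :* i)) :=
                                  (r :* r :* r :- r :* s :* s) :* (i :* i :* i)) refl r s i ⟩
          (r * r * r - r * s * s) * (i * i * i)
            ≈⟨ *-congʳ e ⟨
          γ * (s * s * s) * (i * i * i)
            ≈⟨ solve 3 (λ g s i → g :* (s :* s :* s) :* (i :* i :* i) := g :* (s :* i :* (s :* i) :*
                (s :* i))) refl γ s i ⟩
          γ * (s * i * (s * i) * (s * i))
            ≈⟨ *-congˡ (trans (*-cong (trans (*-cong si≈1 si≈1) (*-identityʳ 1#)) si≈1) (*-identityʳ 1#)) ⟩
          γ * 1#
            ≈⟨ *-identityʳ γ ⟩
          γ ∎) (γ-nonvalue (r * i) (σ-fixed-* fr (fixed-inverse σ-hom si≈1 fs)))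

  scalar-regular : ∀ {k w} → ¬ k ≈ 0# → ι k ⊛ w ≋ ι 0# → w ≋ ι 0#
  scalar-regular {k} {w} k≉0 e = ≋[ coordinate (≋₀ e') , coordinate (≋₁ e') , coordinate (≋₂ e') ]
    where
    e' = R.trans (R.sym (ι* k w)) e
    coordinate : ∀ {x} → k * x ≈ 0# → x ≈ 0#
    coordinate kx≈0 = cancel-nonzero k≉0 (trans (*-comm _ _) kx≈0)

  private
    regular-via : ∀ {z w} v {k} → v ⊛ z ≋ k → z ⊛ w ≋ ι 0# → k ⊛ w ≋ ι 0#
    regular-via {z} {w} v vz≋k zw≋0 = R.trans (R.*-congʳ {x = w} (R.sym vz≋k))
      (R.trans (R.*-assoc v z w) (R.trans (R.*-congˡ {x = v} zw≋0) (R.zeroʳ v)))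

    -- The cofactor multiplies z₀ + z₁ t to its norm k = γ z₁³ + z₀³ - z₀ z₁². This is a scalar, and
    -- k = 0 would be a zero of the anisotropic form at r = - z₀, s = z₁.
    linear-regular : ∀ {z₀ z₁ w} → σ z₀ ≈ z₀ → σ z₁ ≈ z₁ → ¬ (z₁ ≈ 0# × z₀ ≈ 0#) →
                     [ z₀ , z₁ , 0# ] ⊛ w ≋ ι 0# → w ≋ ι 0#
    linear-regular {z₀} {z₁} f₀ f₁ nonzero e = scalar-regular k≉0
      (regular-via [ z₀ * z₀ - z₁ * z₁ , - (z₀ * z₁) , z₁ * z₁ ] product e)
      where
      k = γ * (z₁ * z₁ * z₁) + z₀ * z₀ * z₀ - z₀ * z₁ * z₁
      product : [ z₀ * z₀ - z₁ * z₁ , - (z₀ * z₁) , z₁ * z₁ ] ⊛ [ z₀ , z₁ , 0# ] ≋ ι k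
      product = ≋[
        solve 3 (λ g a b → (a :* a :- b :* b) :* a :+ g :* (:- (a :* b) :* nil :+ b :* b :* b) :=
                           g :* (b :* b :* b) :+ a :* a :* a :- a :* b :* b) refl γ z₀ z₁ ,
        solve 3 (λ g a b → (a :* a :- b :* b) :* b :+ :- (a :* b) :* a :+ (:-
            (a :* b) :* nil :+ b :* b :* b) :+ g :* (b :* b :* nil) := nil)
          refl γ z₀ z₁ ,
        solve 2 (λ a b → (a :* a :- b :* b) :* nil :+ :- (a :* b) :* b :+ b :* b :* a :+ b :* b :* nil
            := nil) refl z₀ z₁ ]
      k≉0 : ¬ k ≈ 0#
      k≉0 k≈0 with cubic-form-anisotropic (σ-fixed-neg f₀) f₁ (x-y≈0⇒x≈y _ _ (trans
        (solve 3 (λ g a b → g :* (b :* b :* b) :- (:- a :* :- a :* :- a :- :- a :* b :* b) :=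
                            g :* (b :* b :* b) :+ a :* a :* a :- a :* b :* b) refl γ z₀ z₁) k≈0))
      ... | z₁≈0 , -z₀≈0 = nonzero (z₁≈0 , trans (solve 1 (λ a → a := :- :- a) refl z₀) (trans (-‿cong -z₀≈0)
              (solve 0 (:- nil := nil) refl)))

  -- The factor w ranges over all of R, where zero divisors may exist. Euclid's algorithm against t³
  -- - t - γ supplies a multiple of z that is linear and nonzero, whose norm is a nonzero scalar;
  -- anything killed by z is killed by that scalar.
  regular : ∀ {z w} → τ z ≋ z → ¬ z ≋ ι 0# → z ⊛ w ≋ ι 0# → w ≋ ι 0#
  regular {[ z₀ , z₁ , z₂ ]} {w} ≋[ f₀ , f₁ , f₂ ] z≉0 e with z₂ ≟ 0#
  ... | yes z₂≈0 = linear-regular f₀ f₁ (λ { (z₁≈0 , z₀≈0) → z≉0 ≋[ z₀≈0 , z₁≈0 , z₂≈0 ] })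
        (R.trans (R.*-congʳ {x = w} ≋[ refl , refl , sym z₂≈0 ]) e)
  ... | no z₂≉0 = linear-regular
        (σ-fixed-+ (σ-fixed-* (σ-fixed-* f₂ f₂) γ-fixed) (σ-fixed-neg (σ-fixed-* f₀ f₁)))
        (σ-fixed-+ (σ-fixed-+ (σ-fixed-* f₂ f₂) (σ-fixed-* f₀ f₂)) (σ-fixed-neg (σ-fixed-* f₁ f₁)))
        remainder≉0 (regular-via [ - z₁ , z₂ , 0# ] product e)
    where
    -- t³ - t - γ = z · (z₂ t - z₁) / z₂² modulo the remainder r₀ + r₁ t
    r₀ = z₂ * z₂ * γ - z₀ * z₁
    r₁ = z₂ * z₂ + z₀ * z₂ - z₁ * z₁
    product : [ - z₁ , z₂ , 0# ] ⊛ [ z₀ , z₁ , z₂ ] ≋ [ r₀ , r₁ , 0# ]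
    product = ≋[
      solve 4 (λ g a b c → :- b :* a :+ g :* (c :* c :+ nil :* b) := c :* c :* g :- a :* b) refl γ z₀ z₁ z₂ ,
      solve 4 (λ g a b c → :- b :* b :+ c :* a :+ (c :* c :+ nil :* b) :+ g :* (nil :* c)
          := c :* c :+ a :* c :- b :* b)
        refl γ z₀ z₁ z₂ ,
      solve 3 (λ a b c → :- b :* c :+ c :* b :+ nil :* a :+ nil :* c := nil) refl z₀ z₁ z₂ ]
    -- A zero remainder would make z₁/z₂ a root of the cubic: z₂ r₀ + z₁ r₁ is the anisotropic form
    -- at (z₁ , z₂).
    remainder≉0 : ¬ (r₁ ≈ 0# × r₀ ≈ 0#)
    remainder≉0 (r₁≈0 , r₀≈0) = z₂≉0 (proj₁ (cubic-form-anisotropic f₁ f₂ (x-y≈0⇒x≈y _ _ (begin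
      γ * (z₂ * z₂ * z₂) - (z₁ * z₁ * z₁ - z₁ * z₂ * z₂)
        ≈⟨ solve 4 (λ g a b c → g :* (c :* c :* c) :- (b :* b :* b :- b :* c :* c) :=
             c :* (c :* c :* g :- a :* b) :+ b :* (c :* c :+ a :* c :- b :* b)) refl γ z₀ z₁ z₂ ⟩
      z₂ * r₀ + z₁ * r₁
        ≈⟨ +-cong (*-congˡ r₀≈0) (*-congˡ r₁≈0) ⟩
      z₂ * 0# + z₁ * 0#
        ≈⟨ solve 2 (λ a b → a :* nil :+ b :* nil := nil) refl z₂ z₁ ⟩
      0# ∎))))

  -- Eliminating m from the t and t² coordinates of Y² - m Y + d leaves the anisotropic cubic form.
  not-quadratic : ∀ {Y} → τ Y ≋ Y → ¬ c₁ Y ≈ 0# → ∀ m d → ¬ Y R.* Y R.- ι m R.* Y R.+ ι d ≋ ι 0#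
  not-quadratic {[ y₀ , y₁ , y₂ ]} ≋[ f₀ , f₁ , f₂ ] y₁≉0 m d ≋[ _ , e₁ , e₂ ] =
    y₁≉0 (proj₂ (cubic-form-anisotropic f₁ f₂ (x-y≈0⇒x≈y _ _ (begin
      γ * (y₂ * y₂ * y₂) - (y₁ * y₁ * y₁ - y₁ * y₂ * y₂)
        ≈⟨ solve 5 (λ g a b c m →
             g :* (c :* c :* c) :- (b :* b :* b :- b :* c :* c) :=
             c :* ((a :* b :+ b :* a :+ (b :* c :+ c :* b) :+ g :* (c :* c))
                   :+ :- (m :* b :+ nil :* a :+ (nil :* c :+ nil :* b) :+ g :* (nil :* c)) :+ nil)
             :- b :* ((a :* c :+ b :* b :+ c :* a :+ c :* c)
                   :+ :- (m :* c :+ nil :* b :+ nil :* a :+ nil :* c) :+ nil)) refl γ y₀ y₁ y₂ m ⟩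
      _ ≈⟨ +-cong (*-congˡ e₁) (-‿cong (*-congˡ e₂)) ⟩
      y₂ * 0# - y₁ * 0#
        ≈⟨ solve 2 (λ a b → a :* nil :- b :* nil := nil) refl y₂ y₁ ⟩
      0# ∎))))

-- Degree of the norm of x + t, and the scattered subspace.

degree : ℕ → ℕ → ℕ
degree q zero    = 0
degree q (suc j) = degree q j ℕ.+ q ℕ.^ suc j

-- With j = n - 1 this places the degree of the t-coordinate below q^n, the number of elements of F,
-- so a non-root can be found in F.
degree+2≤q^ : ∀ {q} → 2 ℕ.≤ q → ∀ j → degree q j ℕ.+ 2 ℕ.≤ q ℕ.^ suc j
degree+2≤q^ {q} 2≤q zero    = ℕₚ.≤-trans 2≤q (ℕₚ.≤-reflexive (≡.sym (ℕₚ.*-identityʳ q)))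
degree+2≤q^ {q} 2≤q (suc j) = begin
  degree q j ℕ.+ Q ℕ.+ 2   ≡⟨ xy∙z≈xz∙y (degree q j) Q 2 ⟩
  degree q j ℕ.+ 2 ℕ.+ Q   ≤⟨ ℕₚ.+-monoˡ-≤ Q (degree+2≤q^ 2≤q j) ⟩
  Q ℕ.+ Q                  ≡⟨ ≡.cong (Q ℕ.+_) (ℕₚ.+-identityʳ Q) ⟨
  2 ℕ.* Q                  ≤⟨ ℕₚ.*-monoˡ-≤ Q 2≤q ⟩
  q ℕ.* Q                  ∎
  where
  open ℕₚ.≤-Reasoning
  open import Algebra.Properties.CommutativeSemigroup ℕₚ.+-commutativeSemigroup using (xy∙z≈xz∙y)
  Q = q ℕ.^ suc j

module MaximumScattered {c ℓ} (K : CommutativeRing c ℓ) (isField : IsField K)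
  {q n} (size : HasSize K (q ℕ.^ (2 ℕ.* n))) (2≤q : 2 ℕ.≤ q) (1≤n : 1 ℕ.≤ n)
  (σ-hom : IsRingHomomorphism (CommutativeRing.rawRing K) (CommutativeRing.rawRing K) (λ x → pow K x q))
  {γ : CommutativeRing.Carrier K} (γ-fixed : InFq K q γ) (γ-nonvalue : NotCubicValue K (λ x → pow K x q) γ)
  where
  open CommutativeRing K hiding (zero) renaming (Carrier to A)
  open FiniteField K isField size
  open Roots K isField size
  open FrobeniusFixedField K isField {q} {n} size 2≤q 1≤n σ-hom
  open CubicExtension K γ
  open FqCubicField K isField size σ-hom γ-fixed γ-nonvalue
  open SubfieldSpans K isField size 2≤q σ-hom
  open IntegerSolver K
  open import Relation.Binary.Reasoning.Setoid setoid
  open import Algebra.Properties.Ring ring using () renaming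
      (x∙y⁻¹≈ε⇒x≈y to x-y≈0⇒x≈y; x≈y⇒x∙y⁻¹≈ε to x≈y⇒x-y≈0)
  private
    module R = CommutativeRing cubicRing
    module σ = IsRingHomomorphism σ-hom
    module τ = IsRingHomomorphism τ-hom
    module σⁿ = IsRingHomomorphism σⁿ-hom
    ι-hom = ι-isRingHomomorphism
    module ι = IsRingHomomorphism ι-hom
    module NK = Norm K σ-hom
  open Norm cubicRing τ-hom

  τι≋ισ : ∀ k → τ (ι k) ≋ ι (σ k)
  τι≋ισ k = ≋[ refl , σ.0#-homo , σ.0#-homo ]

  norm-ι : ∀ k x → norm k (ι x) ≋ ι (NK.norm k x)
  norm-ι zero    x = R.refl
  norm-ι (suc k) x = R.trans (R.*-congˡ {x = ι x} (R.trans (τ.⟦⟧-cong (norm-ι k x)) (τι≋ισ _))) (R.sym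
      (ι.*-homo x _))

  σ≉0 : ∀ {y} → ¬ y ≈ 0# → ¬ σ y ≈ 0#
  σ≉0 {y} y≉0 σy≈0 with proj₂ isField y y≉0
  ... | z , yz≈1 = 1≉0 (begin
    1#          ≈⟨ σ.1#-homo ⟨
    σ 1#        ≈⟨ σ.⟦⟧-cong yz≈1 ⟨
    σ (y * z)   ≈⟨ σ.*-homo y z ⟩
    σ y * σ z   ≈⟨ *-congʳ σy≈0 ⟩
    0# * σ z    ≈⟨ zeroˡ _ ⟩
    0#          ∎)

  normₖ≉0 : ∀ k {x} → ¬ x ≈ 0# → ¬ NK.norm k x ≈ 0#
  normₖ≉0 zero    x≉0 = 1≉0
  normₖ≉0 (suc k) x≉0 = *-nonzero x≉0 (σ≉0 (normₖ≉0 k x≉0))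

  x+t : A → Cubic
  x+t x = [ x , 1# , 0# ]

  iter-τ : ∀ k x → iter τ k x ≡ [ iter σ k (c₀ x) , iter σ k (c₁ x) , iter σ k (c₂ x) ]
  iter-τ zero    x = ≡.refl
  iter-τ (suc k) x = ≡.cong τ (iter-τ k x)

  iter-τ-x+t : ∀ k x → iter τ k (x+t x) ≋ x+t (pow K x (q ℕ.^ k))
  iter-τ-x+t k x = R.trans (R.reflexive (iter-τ k (x+t x)))
    ≋[ iter-σ k x , iter-fixed k σ.1#-homo , iter-fixed k σ.0#-homo ]

  -- In the product of the factors x^(q^i) + t for i ≤ j, the leading term of the t-coordinate takes
  -- t from the factor i = 0, so it is monic of degree q + ⋯ + q^j. Taking t from no factor gives
  -- degree one more in coordinate 0, whence the bound + 2; the t²-coordinate needs t from at least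
  -- two factors and stays lower. The reduction of t³ only adds terms within these bounds.
  norm-x+t : ∀ j → Low (degree q j ℕ.+ 2) (λ x → c₀ (norm (suc j) (x+t x)))
                 × Monic (degree q j) (λ x → c₁ (norm (suc j) (x+t x)))
                 × Low (degree q j) (λ x → c₂ (norm (suc j) (x+t x)))
  norm-x+t zero =
    low-cong (λ x → trans (≋₀ (norm-1 x)) (sym (trans (+-identityˡ _) (*-identityʳ x)))) (low-suc 0#
        (low-const 1#) (λ _ → refl)) ,
    monic-zero (λ x → ≋₁ (norm-1 x)) ,
    low-zero (λ x → ≋₂ (norm-1 x))
    where
    norm-1 : ∀ x → norm 1 (x+t x) ≋ x+t x
    norm-1 x = R.trans (norm-sucʳ 0 (x+t x)) (R.*-identityˡ (x+t x))
  norm-x+t (suc j) with norm-x+t j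
  ... | low₀ , monic₁ , low₂ =
    low-cong (λ x → trans (≋₀ (step x)) (coordinate₀ _ _ _ _)) (low-+
      (low-mono 2+ (low-*-monic low₀ monic-v))
      (low-mono (ℕₚ.≤-trans (ℕₚ.m≤m+n _ Q) (ℕₚ.m≤m+n _ 2)) (low-scale γ low₂))) ,
    monic-cong (λ x → trans (≋₁ (step x)) (coordinate₁ _ _ _ _)) (monic-+-low (monic-* monic₁ monic-v)
      (low-+ (low-mono (ℕₚ.+-monoʳ-≤ (degree q j) 2≤Q) low₀) (low-mono (ℕₚ.m≤m+n (degree q j) Q) low₂))) ,
    low-cong (λ x → trans (≋₂ (step x)) (coordinate₂ _ _ _ _)) (low-+
      (low-mono 1+ (monic⇒low monic₁)) (low-*-monic low₂ monic-v))
    where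
    Q = q ℕ.^ suc j

    monic-v : Monic Q (λ x → pow K x Q)
    monic-v = monic-pow Q

    2≤Q : 2 ℕ.≤ Q
    2≤Q = ℕₚ.≤-trans (ℕₚ.m≤n+m 2 (degree q j)) (degree+2≤q^ 2≤q j)

    2+ : degree q j ℕ.+ 2 ℕ.+ Q ℕ.≤ degree q j ℕ.+ Q ℕ.+ 2
    2+ = ℕₚ.≤-reflexive (xy∙z≈xz∙y (degree q j) 2 Q)
      where open import Algebra.Properties.CommutativeSemigroup ℕₚ.+-commutativeSemigroup using (xy∙z≈xz∙y)

    1+ : suc (degree q j) ℕ.≤ degree q j ℕ.+ Q
    1+ = ℕₚ.≤-trans (ℕₚ.≤-reflexive (ℕₚ.+-comm 1 (degree q j))) (ℕₚ.+-monoʳ-≤ (degree q j) (ℕₚ.<⇒≤ 2≤Q))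

    step : ∀ x → norm (suc (suc j)) (x+t x) ≋ norm (suc j) (x+t x) ⊛ x+t (pow K x Q)
    step x = R.trans (norm-sucʳ (suc j) (x+t x)) (R.*-congˡ {x = norm (suc j) (x+t x)} (iter-τ-x+t (suc j) x))

    coordinate₀ : ∀ p₀ p₁ p₂ v → p₀ * v + γ * (p₁ * 0# + p₂ * 1#) ≈ p₀ * v + γ * p₂
    coordinate₀ = solve 5 (λ g p₀ p₁ p₂ v → p₀ :* v :+ g :* (p₁ :* nil :+ p₂ :* one)
        := p₀ :* v :+ g :* p₂) refl γ

    coordinate₁ : ∀ p₀ p₁ p₂ v → p₀ * 1# + p₁ * v + (p₁ * 0# + p₂ * 1#) + γ * (p₂ * 0#) ≈ p₁ * v + (p₀ + p₂)
    coordinate₁ = solve 5 (λ g p₀ p₁ p₂ v → p₀ :* one :+ p₁ :* v :+ (p₁ :* nil :+ p₂ :* one) :+ g :*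
        (p₂ :* nil) :=
                                            p₁ :* v :+ (p₀ :+ p₂)) refl γ

    coordinate₂ : ∀ p₀ p₁ p₂ v → p₀ * 0# + p₁ * 1# + p₂ * v + p₂ * 0# ≈ p₁ + p₂ * v
    coordinate₂ = solve 4 (λ p₀ p₁ p₂ v → p₀ :* nil :+ p₁ :* one :+ p₂ :* v :+ p₂ :* nil := p₁ :+ p₂ :* v) refl

  norm-t-coordinate : ∃ λ u → σⁿ u ≈ u × ¬ c₁ (norm n (x+t u)) ≈ 0#
  norm-t-coordinate = helper n ≡.refl 1≤n fixed-elements
    where
    helper : ∀ k → k ≡ n → 1 ℕ.≤ k → (∃ λ (h : Fin (q ℕ.^ n) → A) → (∀ i j → h i ≈ h j → i ≡ j) × (∀ i →
        σⁿ (h i) ≈ h i)) →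
             ∃ λ u → σⁿ u ≈ u × ¬ c₁ (norm n (x+t u)) ≈ 0#
    helper (suc j) ≡.refl _ (h , inj , fix) with nonroot (proj₁ (proj₂ (norm-x+t j))) h inj
      (ℕₚ.≤-trans (≡.subst (ℕ._≤ degree q j ℕ.+ 2) (ℕₚ.+-comm (degree q j) 1) (ℕₚ.+-monoʳ-≤ (degree q j)
          (ℕ.s≤s ℕ.z≤n))) (degree+2≤q^ 2≤q j))
    ... | i , nonzero = h i , fix i , nonzero

  module Subspace {ω u : A} (ω-moved : ¬ σⁿ ω ≈ ω) (u-fixed : σⁿ u ≈ u)
                  (t-coordinate≉0 : ¬ c₁ (norm n (x+t u)) ≈ 0#) where
    module PP = ProportionalPoints K cubicRing ι-hom σ-hom τ-hom τι≋ισ n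
    open PP using (Fixed; fixed-+; fixed-*; fixed-ι; fixed-τ)

    a : Cubic
    a = x+t u

    coordinates-fixed : ∀ {x} → Fixed x → σⁿ (c₀ x) ≈ c₀ x × σⁿ (c₁ x) ≈ c₁ x × σⁿ (c₂ x) ≈ c₂ x
    coordinates-fixed {x} fx = ≋₀ e , ≋₁ e , ≋₂ e
      where e = R.trans (R.sym (R.reflexive (iter-τ n x))) fx

    fixed-coordinates : ∀ {x₀ x₁ x₂} → σⁿ x₀ ≈ x₀ → σⁿ x₁ ≈ x₁ → σⁿ x₂ ≈ x₂ → Fixed [ x₀ , x₁ , x₂ ]
    fixed-coordinates f₀ f₁ f₂ = R.trans (R.reflexive (iter-τ n _)) ≋[ f₀ , f₁ , f₂ ]

    a-fixed : Fixed a
    a-fixed = fixed-coordinates u-fixed σⁿ.1#-homo σⁿ.0#-homo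

    norm-regular : ∀ {w} → norm n a ⊛ w ≋ ι 0# → w ≋ ι 0#
    norm-regular {w} = regular {z = norm n a} {w} (norm-fixed n a-fixed) (λ e → t-coordinate≉0 (≋₁ e))

    -- The element a has coefficients in F and need not lie in E, but it divides N(a), which does
    -- and is nonzero. Positivity of n is what exhibits a as a factor of N(a).
    a-regular : ∀ {w} → a ⊛ w ≋ ι 0# → w ≋ ι 0#
    a-regular {w} aw≋0 = norm-regular (helper n 1≤n)
      where
      helper : ∀ k → 1 ℕ.≤ k → norm k a ⊛ w ≋ ι 0#
      helper (suc k) _ = R.trans (R.*-congʳ {x = w} (R.*-comm a (τ (norm k a))))
        (R.trans (R.*-assoc (τ (norm k a)) a w) (R.trans (R.*-congˡ {x = τ (norm k a)} aw≋0) (R.zeroʳ _)))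

    τ-injective : ∀ {x} → Fixed x → τ x ≋ ι 0# → x ≋ ι 0#
    τ-injective {x} fx τx≋0 = R.trans (R.sym fx) (helper n 1≤n)
      where
      helper : ∀ k → 1 ℕ.≤ k → iter τ k x ≋ ι 0#
      helper (suc k) _ = R.trans (R.reflexive (≡.sym (iter-suc τ k x)))
        (R.trans (τᵏ.⟦⟧-cong τx≋0) τᵏ.0#-homo)
        where module τᵏ = IsRingHomomorphism (iter-isRingHomomorphism cubicRing τ-hom k)

    ω̄ = σⁿ ω

    ω-ω̄≉0 : ¬ ω - ω̄ ≈ 0#
    ω-ω̄≉0 e = ω-moved (sym (x-y≈0⇒x≈y ω ω̄ e))

    -- Subtracting the σⁿ-conjugate relation leaves x (ω - ω̄) = 0.
    ω-independentₖ : ∀ {x y} → σⁿ x ≈ x → σⁿ y ≈ y → ω * x + y ≈ 0# → x ≈ 0# × y ≈ 0#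
    ω-independentₖ {x} {y} fx fy e = x≈0 , (begin
      y                 ≈⟨ +-identityˡ y ⟨
      0# + y            ≈⟨ +-congʳ (trans (*-congˡ x≈0) (zeroʳ ω)) ⟨
      ω * x + y         ≈⟨ e ⟩
      0#                ∎)
      where
      conjugate : ω̄ * x + y ≈ 0#
      conjugate = begin
        ω̄ * x + y              ≈⟨ +-cong (*-congˡ fx) fy ⟨
        ω̄ * σⁿ x + σⁿ y        ≈⟨ +-congʳ (σⁿ.*-homo ω x) ⟨
        σⁿ (ω * x) + σⁿ y      ≈⟨ σⁿ.+-homo _ _ ⟨
        σⁿ (ω * x + y)         ≈⟨ σⁿ.⟦⟧-cong e ⟩
        σⁿ 0#                  ≈⟨ σⁿ.0#-homo ⟩
        0#                     ∎
      x≈0 : x ≈ 0#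
      x≈0 = cancel-nonzero ω-ω̄≉0 (begin
        x * (ω - ω̄)                    ≈⟨ solve 4 (λ x w v y → x :* (w :- v) := w :* x :+ y :-
            (v :* x :+ y)) refl x ω ω̄ y ⟩
        ω * x + y - (ω̄ * x + y)        ≈⟨ +-cong e (-‿cong conjugate) ⟩
        0# - 0#                        ≈⟨ -‿inverseʳ 0# ⟩
        0#                             ∎)

    ω-independent : ∀ {p r} → Fixed p → Fixed r → ι ω ⊛ p ⊕ r ≋ ι 0# → p ≋ ι 0# × r ≋ ι 0#
    ω-independent {p} {r} fp fr e with coordinates-fixed fp | coordinates-fixed fr
    ... | p₀ , p₁ , p₂ | r₀ , r₁ , r₂ = ≋[ proj₁ z₀ , proj₁ z₁ , proj₁ z₂ ] , ≋[ proj₂ z₀ , proj₂ z₁ , proj₂ z₂ ]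
      where
      e' = R.trans (R.+-congʳ {x = r} (R.sym (ι* ω p))) e
      z₀ = ω-independentₖ p₀ r₀ (≋₀ e')
      z₁ = ω-independentₖ p₁ r₁ (≋₁ e')
      z₂ = ω-independentₖ p₂ r₂ (≋₂ e')

    Φ : Cubic → Cubic
    Φ x = ι ω ⊛ x ⊕ a ⊛ τ x

    Φ-injective : ∀ {x} → Fixed x → Φ x ≋ ι 0# → x ≋ ι 0#
    Φ-injective fx e = proj₁ (ω-independent fx (fixed-* a-fixed (fixed-τ fx)) e)

    toCubic : V3 K → Cubic
    toCubic v = [ v 0F , v 1F , v 2F ]

    U : V3 K → Set (c ⊔ ℓ)
    U v = ∃ λ x → Fixed x × toCubic v ≋ Φ x

    Φ-+ : ∀ x y → Φ (x ⊕ y) ≋ Φ x ⊕ Φ y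
    Φ-+ x y = R.trans (R.+-congˡ {x = ι ω ⊛ (x ⊕ y)} (R.*-congˡ {x = a} (τ.+-homo x y))) (ring-identity
        (ι ω) a x y (τ x) (τ y))
      where
      ring-identity : ∀ w a x y s t → w R.* (x R.+ y) R.+ a R.* (s R.+ t) R.≈ w R.* x R.+ a R.* s R.+
          (w R.* y R.+ a R.* t)
      ring-identity w a x y s t = R.trans (R.+-cong (R.distribˡ w x y) (R.distribˡ a s t)) (interchange
          (w R.* x) (w R.* y) (a R.* s) (a R.* t))
        where open import Algebra.Properties.CommutativeSemigroup R.+-commutativeSemigroup using (interchange)

    Φ-neg : ∀ x → Φ (⊖ x) ≋ ⊖ Φ x
    Φ-neg x = R.trans (R.+-cong (R.sym (-‿distribʳ-* (ι ω) x)) (R.trans (R.*-congˡ {x = a} (τ.-‿homo x))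
        (R.sym (-‿distribʳ-* a (τ x)))))
                      (-‿+-comm (ι ω ⊛ x) (a ⊛ τ x))
      where open import Algebra.Properties.Ring R.ring using (-‿distribʳ-*; -‿+-comm)

    Φ-· : ∀ {m} x → σ m ≈ m → Φ (ι m ⊛ x) ≋ ι m ⊛ Φ x
    Φ-· {m} x fix = R.trans (R.+-cong (x∙yz≈y∙xz (ι ω) (ι m) x)
        (R.trans (R.*-congˡ {x = a} (R.trans (τ.*-homo (ι m) x) (R.*-congʳ {x = τ x} (R.trans (τι≋ισ m)
            (ι.⟦⟧-cong fix)))))
                 (x∙yz≈y∙xz a (ι m) (τ x))))
      (R.sym (R.distribˡ (ι m) (ι ω ⊛ x) (a ⊛ τ x)))
      where open import Algebra.Properties.CommutativeSemigroup R.*-commutativeSemigroup using (x∙yz≈y∙xz)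

    Φ-0 : ∀ {x} → x ≋ ι 0# → Φ x ≋ ι 0#
    Φ-0 {x} x≋0 = R.trans (R.+-cong (R.trans (R.*-congˡ {x = ι ω} x≋0) (R.zeroʳ (ι ω)))
                                    (R.trans (R.*-congˡ {x = a} (R.trans (τ.⟦⟧-cong x≋0) τ.0#-homo))
                                        (R.zeroʳ a)))
                          (R.+-identityˡ (ι 0#))

    U-isFqSubspace : IsFqSubspace U
    U-isFqSubspace = record
      { resp = λ { w≈v (x , fx , v≋) → x , fx , R.trans ≋[ w≈v 0F , w≈v 1F , w≈v 2F ] v≋ }
      ; 0-closed = ι 0# , fixed-ι σⁿ.0#-homo , R.sym (Φ-0 R.refl)
      ; +-closed = λ { (x , fx , v≋) (y , fy , w≋) →
          x ⊕ y , fixed-+ fx fy , R.trans (R.+-cong v≋ w≋) (R.sym (Φ-+ x y)) }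
      ; ·-closed = λ { {m} {v} fix (x , fx , v≋) →
          ι m ⊛ x , fixed-* (fixed-ι (iter-fixed n fix)) fx ,
          R.trans (R.sym (ι* m (toCubic v))) (R.trans (R.*-congˡ {x = ι m} v≋) (R.sym (Φ-· x fix))) } }

    ω̄-minimal : ω * ω ≈ (ω + ω̄) * ω + - (ω * ω̄)
    ω̄-minimal = solve 2 (λ w v → w :* w := (w :+ v) :* w :+ :- (w :* v)) refl ω ω̄

    module _ {k : A} where
      private
        i = proj₁ (proj₂ isField (ω - ω̄) ω-ω̄≉0)

        k̄ = σⁿ k

      -- Cramer's rule for the system k = α + β ω, k̄ = α + β ω̄.
      β α : A
      β = (k - k̄) * i
      α = k - β * ω

      private
        βd : β * (ω - ω̄) ≈ k - k̄
        βd = trans (solve 3 (λ x i d → x :* i :* d := x :* (d :* i)) refl _ i (ω - ω̄))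
                   (trans (*-congˡ (proj₂ (proj₂ isField (ω - ω̄) ω-ω̄≉0))) (*-identityʳ _))

        σⁿ-difference : ∀ x y → σⁿ (x - y) ≈ σⁿ x - σⁿ y
        σⁿ-difference x y = trans (σⁿ.+-homo _ _) (+-congˡ (σⁿ.-‿homo y))

      -- Both k - k̄ and ω - ω̄ change sign under σⁿ, so their quotient is fixed.
      β-fixed : σⁿ β ≈ β
      β-fixed = *-cancelʳ ω-ω̄≉0 (begin
        σⁿ β * (ω - ω̄)            ≈⟨ *-congˡ (+-congʳ (σⁿσⁿ ω)) ⟨
        σⁿ β * (σⁿ ω̄ - ω̄)         ≈⟨ solve 3 (λ b w v → b :* (v :- w) := :- (b :* (w :- v))) refl _ _ _ ⟩
        - (σⁿ β * (ω̄ - σⁿ ω̄))     ≈⟨ -‿cong (*-congˡ (σⁿ-difference ω ω̄)) ⟨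
        - (σⁿ β * σⁿ (ω - ω̄))     ≈⟨ -‿cong (σⁿ.*-homo _ _) ⟨
        - σⁿ (β * (ω - ω̄))        ≈⟨ -‿cong (σⁿ.⟦⟧-cong βd) ⟩
        - σⁿ (k - k̄)              ≈⟨ -‿cong (σⁿ-difference k k̄) ⟩
        - (k̄ - σⁿ k̄)              ≈⟨ -‿cong (+-congˡ (-‿cong (σⁿσⁿ k))) ⟩
        - (k̄ - k)                 ≈⟨ solve 2 (λ x y → :- (y :- x) := x :- y) refl k k̄ ⟩
        k - k̄                     ≈⟨ βd ⟨
        β * (ω - ω̄)               ∎)

      α-fixed : σⁿ α ≈ α
      α-fixed = begin
        σⁿ (k - β * ω)            ≈⟨ σⁿ-difference k (β * ω) ⟩
        k̄ - σⁿ (β * ω)            ≈⟨ +-congˡ (-‿cong (trans (σⁿ.*-homo β ω) (*-congʳ β-fixed))) ⟩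
        k̄ - β * ω̄                 ≈⟨ solve 5 (λ x y b w v → y :- b :* v := x :- b :* w :-
            (x :- y :- b :* (w :- v))) refl k k̄ β ω ω̄ ⟩
        α - (k - k̄ - β * (ω - ω̄)) ≈⟨ +-congˡ (-‿cong (x≈y⇒x-y≈0 (sym βd))) ⟩
        α - 0#                    ≈⟨ solve 1 (λ x → x :- nil := x) refl α ⟩
        α                         ∎

      α+βω : k ≈ α + β * ω
      α+βω = solve 2 (λ k x → k := k :- x :+ x) refl k (β * ω)

    module Ratio {k : A} {x y : Cubic} (x-fixed : Fixed x) (y-fixed : Fixed y) (x≉0 : ¬ x ≋ ι 0#)
                 (proportional : ι k ⊛ Φ x ≋ Φ y) where
      module Points = PP.Pair {ω} {ω + ω̄} { - (ω * ω̄)} {α {k}} {β {k}} {a} {x} {y} ω-independent ω̄-minimal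
        (trans (σⁿ.+-homo ω ω̄) (trans (+-congˡ (σⁿσⁿ ω)) (+-comm ω̄ ω)))
        (trans (σⁿ.-‿homo _) (-‿cong (trans (σⁿ.*-homo ω ω̄) (trans (*-congˡ (σⁿσⁿ ω)) (*-comm ω̄ ω)))))
        α-fixed β-fixed a-fixed x-fixed y-fixed
        (R.trans (R.*-congʳ {x = Φ x} (ι.⟦⟧-cong (sym α+βω))) proportional)
      open Points using (M; eigenvalue; eigenvalue-fixed; characteristic-equation; ω-coordinate; 1-coordinate)
      module MK = Matrices K σ-hom

      private
        P = MK.power n M
        Y = eigenvalue

      -- The lower right entry of M is zero and B = - ω ω̄, so det M = β σ(β) ω ω̄. Here ω is
      -- nonzero because σⁿ moves it.
      det-M≉0 : ¬ β ≈ 0# → ¬ MK.det M ≈ 0#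
      det-M≉0 β≉0 e = *-nonzero (*-nonzero β≉0 (σ≉0 β≉0)) ωω̄≉0 (trans
        (solve 4 (λ b s w m → b :* s :* w := m :* nil :- b :* (:- w) :* s) refl β (σ β) (ω * ω̄) (MK.m₁₁ M)) e)
        where
        ω≉0 : ¬ ω ≈ 0#
        ω≉0 ω≈0 = ω-moved (trans (σⁿ.⟦⟧-cong ω≈0) (trans σⁿ.0#-homo (sym ω≈0)))
        ωω̄≉0 : ¬ ω * ω̄ ≈ 0#
        ωω̄≉0 = *-nonzero ω≉0 (λ ω̄≈0 → ω≉0 (trans (sym (σⁿσⁿ ω)) (trans (σⁿ.⟦⟧-cong ω̄≈0) σⁿ.0#-homo)))

      trace-fixed : ¬ β ≈ 0# → σ (MK.trace P) ≈ MK.trace P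
      trace-fixed β≉0 = MK.trace-power-fixed {n} {M} Points.M-fixed (*-cancelʳ (det-M≉0 β≉0))

      det-fixed : ¬ β ≈ 0# → σ (MK.det P) ≈ MK.det P
      det-fixed β≉0 = MK.det-power-fixed {n} {M} Points.M-fixed (*-cancelʳ (det-M≉0 β≉0))

      Y-t-coordinate≉0 : ¬ β ≈ 0# → ¬ c₁ Y ≈ 0#
      Y-t-coordinate≉0 β≉0 e = *-nonzero (normₖ≉0 n (σ≉0 β≉0)) t-coordinate≉0 (trans (sym (≋₁ factor)) e)
        where
        factor : Y ≋ [ _ * c₀ (norm n a) , NK.norm n (σ β) * c₁ (norm n a) , _ * c₂ (norm n a) ]
        factor = R.trans (norm-* n (ι (σ β)) a)
          (R.trans (R.*-congʳ {x = norm n a} (norm-ι n (σ β))) (ι* (NK.norm n (σ β)) (norm n a)))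

      -- If β is nonzero, trace and determinant of P and the eigenvalue Y are all fixed, so the
      -- characteristic polynomial of P evaluated at Y lies in E. It is nonzero by `not-quadratic`,
      -- hence a non-zero-divisor, yet it kills the nonzero x.
      β≈0 : β ≈ 0#
      β≈0 with β {k} ≟ 0#
      ... | yes e   = e
      ... | no  β≉0 = contradiction (regular {w = x} z-fixed (not-quadratic eigenvalue-fixed
          (Y-t-coordinate≉0 β≉0) _ _)
                                      characteristic-equation) x≉0
        where
        z-fixed : τ (Y R.* Y R.- ι (MK.trace P) R.* Y R.+ ι (MK.det P)) ≋ Y R.* Y R.- ι
            (MK.trace P) R.* Y R.+ ι (MK.det P)
        z-fixed = R.trans (τ.+-homo _ _) (R.+-cong (R.trans (τ.+-homo _ _) (R.+-cong
            (R.trans (τ.*-homo Y Y) (R.*-cong eigenvalue-fixed eigenvalue-fixed))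
            (R.trans (τ.-‿homo _) (R.-‿cong (R.trans (τ.*-homo (ι (MK.trace P)) Y)
              (R.*-cong (R.trans (τι≋ισ _) (ι.⟦⟧-cong (trace-fixed β≉0))) eigenvalue-fixed))))))
          (R.trans (τι≋ισ _) (ι.⟦⟧-cong (det-fixed β≉0))))

      private
        β-term : ∀ z → ι β ⊛ z ≋ ι 0#
        β-term z = R.trans (R.*-congʳ {x = z} (ι.⟦⟧-cong β≈0)) (R.zeroˡ z)

        X = a ⊛ τ x

        y≋αx : y ≋ ι α ⊛ x
        y≋αx = R.trans ω-coordinate (R.trans
          (R.+-cong (R.trans (R.+-congˡ {x = ι α ⊛ x} (R.trans (R.*-assoc (ι β) (ι (ω + ω̄)) x) (β-term
              (ι (ω + ω̄) ⊛ x)))) (R.+-identityʳ (ι α ⊛ x)))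
                    (β-term X))
          (R.+-identityʳ (ι α ⊛ x)))

        aτy≋αX : a ⊛ τ y ≋ ι α ⊛ X
        aτy≋αX = R.trans 1-coordinate (R.trans
          (R.+-congˡ {x = ι α ⊛ X} (R.trans (R.*-assoc (ι β) (ι (- (ω * ω̄))) x) (β-term (ι (- (ω * ω̄)) ⊛ x))))
          (R.+-identityʳ (ι α ⊛ X)))

        aτy≋σαX : a ⊛ τ y ≋ ι (σ α) ⊛ X
        aτy≋σαX = R.trans (R.*-congˡ {x = a} (R.trans (τ.⟦⟧-cong y≋αx) (R.trans (τ.*-homo (ι α) x)
            (R.*-congʳ {x = τ x} (τι≋ισ α)))))
          (x∙yz≈y∙xz a (ι (σ α)) (τ x))
          where open import Algebra.Properties.CommutativeSemigroup R.*-commutativeSemigroup using (x∙yz≈y∙xz)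

        -- For β = 0 both coordinates describe the same vector: y = α x gives a τ(y) = σ(α) X, while
        -- the second coordinate gives α X.
        difference-kills : ι (σ α - α) ⊛ X ≋ ι 0#
        difference-kills = R.trans (R.*-congʳ {x = X} (R.trans (ι.+-homo _ _) (R.+-congˡ {x = ι (σ α)}
            (ι.-‿homo α))))
          (R.trans (R.distribʳ X (ι (σ α)) (⊖ ι α))
          (R.trans (R.+-cong (R.trans (R.sym aτy≋σαX) aτy≋αX) (R.sym (-‿distribˡ-* (ι α) X)))
                   (R.-‿inverseʳ (ι α ⊛ X))))
          where open import Algebra.Properties.Ring R.ring using (-‿distribˡ-*)

        α-in-Fq : σ α ≈ α
        α-in-Fq with σ (α {k}) - α {k} ≟ 0#
        ... | yes e = x-y≈0⇒x≈y _ _ e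
        -- The scalar, then a, then τ are stripped from (σ(α) - α) a τ(x) = 0, leaving x = 0.
        ... | no nonzero = contradiction (τ-injective x-fixed (a-regular {w = τ x}
            (scalar-regular {w = X} nonzero difference-kills))) x≉0

      k-in-Fq : σ k ≈ k
      k-in-Fq = trans (σ.⟦⟧-cong k≈α) (trans α-in-Fq (sym k≈α))
        where
        k≈α : k ≈ α
        k≈α = trans α+βω (trans (+-congˡ (trans (*-congʳ β≈0) (zeroˡ ω))) (+-identityʳ α))

    infix 4 _≈ᵥ_
    _≈ᵥ_ : V3 K → V3 K → Set ℓ
    _≈ᵥ_ = _≈v_ K

    ratio-in-Fq : ∀ {v w} m → U v → U w → ¬ v ≈ᵥ 0v K → w ≈ᵥ _·v_ K m v → InFq K q m
    ratio-in-Fq {v} {w} m (x , fx , v≋) (y , fy , w≋) v≉0 w≈mv = Ratio.k-in-Fq {m} {x} {y} fx fy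
      (λ x≋0 → let v≋0 = R.trans v≋ (Φ-0 x≋0) in v≉0 (λ { 0F → ≋₀ v≋0 ; 1F → ≋₁ v≋0 ; 2F → ≋₂ v≋0 }))
      (R.trans (R.*-congˡ {x = ι m} (R.sym v≋)) (R.trans (ι* m (toCubic v))
        (R.trans ≋[ sym (w≈mv 0F) , sym (w≈mv 1F) , sym (w≈mv 2F) ] w≋)))

    fromCubic : Cubic → V3 K
    fromCubic x 0F = c₀ x
    fromCubic x 1F = c₁ x
    fromCubic x 2F = c₂ x

    module _ (h : Fin (q ℕ.^ n) → A) (h-injective : ∀ i j → h i ≈ h j → i ≡ j) (h-fixed : ∀ i → σⁿ
        (h i) ≈ h i) where
      triple : Fin ((q ℕ.^ n) ℕ.^ 3) → Cubic
      triple i = [ h (digit 0F) , h (digit 1F) , h (digit 2F) ]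
        where digit = Fin.finToFun {q ℕ.^ n} {3} i

      triple-fixed : ∀ i → Fixed (triple i)
      triple-fixed i = fixed-coordinates (h-fixed _) (h-fixed _) (h-fixed _)

      triple-injective : ∀ i j → triple i ≋ triple j → i ≡ j
      triple-injective i j e = finToFun-injective {3} {q ℕ.^ n} i j
        (λ { 0F → h-injective _ _ (≋₀ e) ; 1F → h-injective _ _ (≋₁ e) ; 2F → h-injective _ _ (≋₂ e) })

      point : Fin ((q ℕ.^ n) ℕ.^ 3) → V3 K
      point i = fromCubic (Φ (triple i))

      point-injective : ∀ i j → point i ≈ᵥ point j → i ≡ j
      point-injective i j e = triple-injective i j (RG.x∙y⁻¹≈ε⇒x≈y (triple i) (triple j)
        (Φ-injective (fixed-+ (triple-fixed i) (PP.fixed-neg (triple-fixed j)))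
          (R.trans (Φ-+ (triple i) (⊖ triple j)) (R.trans (R.+-congˡ {x = Φ (triple i)} (Φ-neg (triple j)))
            (R.trans (R.+-congʳ {x = ⊖ Φ (triple j)} ≋[ e 0F , e 1F , e 2F ]) (R.-‿inverseʳ (Φ (triple j))))))))
        where module RG = Algebra.Properties.Ring R.ring

      scattered-set : ExistsScatteredLinearSet K q (3 ℕ.* n)
      scattered-set = proj₁ family , proj₂ (proj₂ family) ,
        scattered U-isFqSubspace ratio-in-Fq (3 ℕ.* n) (λ i → U-point (proj₁ (proj₁ (proj₂ family) i))
            (proj₂ (proj₁ (proj₂ family) i)))
        where
        family = independent-family point point-injective (3 ℕ.* n)
          (ℕₚ.≤-reflexive (≡.trans (≡.cong (q ℕ.^_) (ℕₚ.*-comm 3 n)) (≡.sym (ℕₚ.^-*-assoc q n 3))))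
        U-point : ∀ {v} j → v ≡ point j → U v
        U-point j ≡.refl = triple j , triple-fixed j , R.refl

-- Assembling the choices of γ, ω and u, and specialising to prime powers.

module _ {c ℓ} (K : CommutativeRing c ℓ) (isField : IsField K)
  {q n} (size : HasSize K (q ℕ.^ (2 ℕ.* n))) (2≤q : 2 ℕ.≤ q) (1≤n : 1 ℕ.≤ n)
  (σ-hom : IsRingHomomorphism (CommutativeRing.rawRing K) (CommutativeRing.rawRing K) (λ x → pow K x q)) where

  maximum-scattered : ExistsScatteredLinearSet K q (3 ℕ.* n)
  maximum-scattered = with-cubic cubic-nonvalue
    where
    open CommutativeRing K
    open FrobeniusFixedField K isField {q} {n} size 2≤q 1≤n σ-hom

    with-cubic : (∃ λ γ → σ γ ≈ γ × NotCubicValue K σ γ) → ExistsScatteredLinearSet K q (3 ℕ.* n)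
    with-cubic (γ , γ-fixed , γ-nonvalue) = with-subspace moved-element norm-t-coordinate fixed-elements
      where
      open MaximumScattered K isField {q} {n} size 2≤q 1≤n σ-hom γ-fixed γ-nonvalue
      with-subspace : (∃ λ ω → ¬ σⁿ ω ≈ ω) → _ → _ → ExistsScatteredLinearSet K q (3 ℕ.* n)
      with-subspace (ω , ω-moved) (u , u-fixed , t≉0) (h , h-injective , h-fixed) =
        Subspace.scattered-set ω-moved u-fixed t≉0 h h-injective h-fixed

maximum-scattered-over : ∀ {c ℓ} n → 1 ℕ.≤ n → ∀ q → IsPrimePower q →
  ∀ (K : CommutativeRing c ℓ) → IsField K → HasSize K (q ℕ.^ (2 ℕ.* n)) → ExistsScatteredLinearSet K q (3 ℕ.* n)
maximum-scattered-over n 1≤n q (p , e , pr , 1≤e , ≡.refl) K isField size =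
  maximum-scattered K isField {q} {n} size 2≤q 1≤n
    -- K has p^(e · 2n) elements, hence characteristic p, and x ↦ x^q is the e-th iterate of the
    -- p-power map.
    (F.Frobenius.frobenius-isRingHomomorphism pr (F.characteristic {p} {e ℕ.* (2 ℕ.* n)}
        (ℕₚ.^-*-assoc p e (2 ℕ.* n))) e)
  where
  module F = FiniteField K isField size
  instance _ = prime⇒nonZero pr
  2≤q : 2 ℕ.≤ p ℕ.^ e
  2≤q = ℕₚ.≤-trans (ℕ.nonTrivial⇒n>1 p {{prime⇒nonTrivial pr}})
    (ℕₚ.≤-trans (ℕₚ.≤-reflexive (≡.sym (ℕₚ.*-identityʳ p))) (ℕₚ.^-monoʳ-≤ p 1≤e))

open import Data.Nat using (ℕ; _≤_; _*_; _^_; _%_)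

theorem2p5 : ∀ {c ℓ : Level} (n : ℕ) → 2 ≤ n →
    ((n % 3 ≢ 0) → ∀ (q : ℕ) → IsPrimePower q →
    ∀ (K : CommutativeRing c ℓ) → IsField K → HasSize K (q ^ (2 * n)) →
    ExistsScatteredLinearSet K q (3 * n))
    ×
    ((n % 3 ≡ 0) → ∀ (q : ℕ) → IsPrimePower q → q % 3 ≡ 1 →
    ∀ (K : CommutativeRing c ℓ) → IsField K → HasSize K (q ^ (2 * n)) →
    ExistsScatteredLinearSet K q (3 * n))
theorem2p5 n 2≤n = (λ _ q q-prime-power K → maximum-scattered-over n (ℕₚ.<⇒≤ 2≤n) q q-prime-power K) ,
                   (λ _ q q-prime-power _ K → maximum-scattered-over n (ℕₚ.<⇒≤ 2≤n) q q-prime-power K)
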